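{- For any $k\in\mathbb{N}$, the problem $k\mathtt{\text{ - }Coloring}$ (deciding whether the vertices of a given graph can be colored with $k$ colors such that no two adjacent vertices get the same color), together with the smoothed extension of $G_{n,p}$ as its parameterized family of distributions, belongs to $\mathsf{Smoothed\text{ - }P}$.
   Context: Parameterized families of distributions. In general, a parameterized family of distributions $\mathcal{D}=(D_{n,x,\phi})_{n,x,\phi}$ consists, for every $n$, every instance $x$ of length $n$ (a problem-dependent size measure) and every admissible $\phi$, of a probability distribution $D_{n,x,\phi}$ with support contained in $\{0,1\}^{\le\mathrm{poly}(n)}$. Let $S_{n,x}=\{y\mid D_{n,x,\phi}(y)>0\text{ for some }\phi\}$ and $N_{n,x}=|S_{n,x}|$. The parameter satisfies $\phi\in[1/N_{n,x},1]$, its values are discretized so that they are described by at most $\mathrm{poly}(n)$ bits, and $D_{n,x,\phi}(y)\le\phi$ for all $n,x,\phi,y$. Smoothed extension of $G_{n,p}$: a graph $G=(V,E)$ on $n$ vertices (its length is $n$) is represented as a binary string of length $\binom n2$, and $N_{n,G}=2^{\binom n2}$. For $\phi\in[2^{ -\binom n2},1]$, let $\varepsilon\le 1/2$ be such that $(1-\varepsilon)^{\binom n2}=\phi$. A random graph $G'=(V,E')$ is drawn from $D_{n,G,\phi}$ by flipping each edge and non-edge of $G$ independently with probability $\varepsilon$: if $e\in E$ then $e\in E'$ with probability $1-\varepsilon$; if $e\notin E$ then $e\in E'$ with probability $\varepsilon$. $\mathsf{Smoothed\text{ - }P}$ is the class of all pairs $(L,\mathcal{D})$ ($L\subseteq\{0,1\}^*$,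 $\mathcal{D}$ a parameterized family of distributions) for which there is a deterministic algorithm $A$ deciding $L$ with smoothed polynomial running time: there exists $\varepsilon'>0$ such that for all $n,x,\phi$, $\mathbb{E}_{y\sim D_{n,x,\phi}}\bigl(t_A(y;n,\phi)^{\varepsilon'}\bigr)=O(n\cdot N_{n,x}\cdot\phi)$, where $t_A(y;n,\phi)$ is the running time of $A$ on input $y$ with parameters $n,\phi$. -}

module Defs where

open import Data.Bool using (Bool; true; false; T)
import Data.Bool.Properties as Bool
open import Data.Fin using (Fin; inject; toℕ)
open import Data.Integer using (+_)
import Data.Integer as ℤ
open import Data.List using (List; []; _∷_; length; map; concatMap; allFin; foldr; replicate)
open import Data.List.Membership.Propositional using (_∈_)
open import Data.List.Relation.Unary.Unique.Propositional using (Unique)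
open import Data.Maybe using (Maybe; just; nothing)
open import Data.Nat as ℕ using (ℕ; zero; suc; NonZero)
open import Data.Nat.Combinatorics using (_C_)
import Data.Nat.Properties as ℕ
open import Data.Product as Product using (Σ; ∃; _×_; _,_)
open import Data.Rational as ℚ using (ℚ; 0ℚ; 1ℚ; ½; ∣_∣; 1/_; ↥_; ↧ₙ_)
import Data.Rational.Properties as ℚ
open import Data.Rational.Solver using (module +-*-Solver)
open import Data.Sum using (_⊎_; inj₁; inj₂; map₂)
open import Data.Vec using (Vec; []; _∷_; zipWith)
import Data.Vec as Vec
open import Function using (_⇔_; _↔_; Injective)
open import Relation.Binary.PropositionalEquality
  using (_≡_; _≢_; refl; sym; trans; cong; cong₂; subst)
open import Relation.Nullary using (yes; no)

-- The reals are Cauchy sequences of rationals with an explicit modulus; two of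
-- them are identified by _≈_ below, not by _≡_.
IsCauchy : (ℕ → ℚ) → Set
IsCauchy s = ∀ δ → 0ℚ ℚ.< δ →
  ∃ λ N → ∀ m n → N ℕ.≤ m → N ℕ.≤ n → ∣ s m ℚ.- s n ∣ ℚ.≤ δ

record ℝ : Set where
  constructor real
  field
    seq    : ℕ → ℚ
    cauchy : IsCauchy seq
open ℝ public

abstract
  ½-split : ∀ δ → ½ ℚ.* δ ℚ.+ ½ ℚ.* δ ≡ δ
  ½-split δ = trans (sym (ℚ.*-distribʳ-+ δ ½ ½)) (ℚ.*-identityˡ δ)

  ½-pos : ∀ {δ} → 0ℚ ℚ.< δ → 0ℚ ℚ.< ½ ℚ.* δ
  ½-pos {δ} δ>0 = ℚ.positive⁻¹ (½ ℚ.* δ) {{ℚ.pos*pos⇒pos ½ δ {{ℚ.positive δ>0}}}}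

  const-cauchy : ∀ q → IsCauchy (λ _ → q)
  const-cauchy q δ δ>0 = 0 , λ _ _ _ _ →
    subst (λ d → ∣ d ∣ ℚ.≤ δ) (sym (ℚ.+-inverseʳ q)) (ℚ.<⇒≤ δ>0)

  +-cauchy : ∀ s t → IsCauchy s → IsCauchy t → IsCauchy (λ n → s n ℚ.+ t n)
  +-cauchy s t cs ct δ δ>0
    with cs (½ ℚ.* δ) (½-pos δ>0) | ct (½ ℚ.* δ) (½-pos δ>0)
  ... | M , p | N , q = M ℕ.⊔ N , λ m n Nm Nn → begin
    ∣ s m ℚ.+ t m ℚ.- (s n ℚ.+ t n) ∣        ≡⟨ cong ∣_∣ (rearrange (s m) (t m) (s n) (t n)) ⟩
    ∣ (s m ℚ.- s n) ℚ.+ (t m ℚ.- t n) ∣      ≤⟨ ℚ.∣p+q∣≤∣p∣+∣q∣ (s m ℚ.- s n) (t m ℚ.- t n) ⟩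
    ∣ s m ℚ.- s n ∣ ℚ.+ ∣ t m ℚ.- t n ∣      ≤⟨ ℚ.+-mono-≤ (p m n (ℕ.m⊔n≤o⇒m≤o M N Nm) (ℕ.m⊔n≤o⇒m≤o M N Nn))
                                                          (q m n (ℕ.m⊔n≤o⇒n≤o M N Nm) (ℕ.m⊔n≤o⇒n≤o M N Nn)) ⟩
    ½ ℚ.* δ ℚ.+ ½ ℚ.* δ                      ≡⟨ ½-split δ ⟩
    δ                                        ∎
    where
    open ℚ.≤-Reasoning
    rearrange : ∀ a b c d → a ℚ.+ b ℚ.- (c ℚ.+ d) ≡ (a ℚ.- c) ℚ.+ (b ℚ.- d)
    rearrange = solve 4 (λ a b c d → a :+ b :- (c :+ d) := (a :- c) :+ (b :- d)) refl
      where open +-*-Solver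

  neg-cauchy : ∀ s → IsCauchy s → IsCauchy (λ n → ℚ.- s n)
  neg-cauchy s cs δ δ>0 with cs δ δ>0
  ... | N , p = N , λ m n Nm Nn →
    subst (ℚ._≤ δ)
      (trans (sym (ℚ.∣-p∣≡∣p∣ (s m ℚ.- s n))) (cong ∣_∣ (ℚ.neg-distrib-+ (s m) (ℚ.- s n))))
      (p m n Nm Nn)

  0<1 : 0ℚ ℚ.< 1ℚ
  0<1 = ℚ.positive⁻¹ 1ℚ

  eventually-bounded : ∀ {s} → IsCauchy s →
    ∃ λ B → 0ℚ ℚ.< B × ∃ λ N → ∀ n → N ℕ.≤ n → ∣ s n ∣ ℚ.≤ B
  eventually-bounded {s} cs with cs 1ℚ 0<1
  ... | N , p = B , ℚ.<-≤-trans 0<1 1≤B , N , λ n Nn → begin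
    ∣ s n ∣                              ≡⟨ cong ∣_∣ (cancel (s n) (s N)) ⟩
    ∣ (s n ℚ.- s N) ℚ.+ s N ∣            ≤⟨ ℚ.∣p+q∣≤∣p∣+∣q∣ (s n ℚ.- s N) (s N) ⟩
    ∣ s n ℚ.- s N ∣ ℚ.+ ∣ s N ∣          ≤⟨ ℚ.+-monoˡ-≤ ∣ s N ∣ (p n N Nn ℕ.≤-refl) ⟩
    B                                    ∎
    where
    open ℚ.≤-Reasoning
    B : ℚ
    B = 1ℚ ℚ.+ ∣ s N ∣
    1≤B : 1ℚ ℚ.≤ B
    1≤B = begin
      1ℚ            ≡⟨ ℚ.+-identityʳ 1ℚ ⟨
      1ℚ ℚ.+ 0ℚ     ≤⟨ ℚ.+-monoʳ-≤ 1ℚ (ℚ.0≤∣p∣ (s N)) ⟩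
      B             ∎
    cancel : ∀ a b → a ≡ (a ℚ.- b) ℚ.+ b
    cancel = solve 2 (λ a b → a := (a :- b) :+ b) refl
      where open +-*-Solver

  apportion : ∀ {A B δ} → 0ℚ ℚ.< A → 0ℚ ℚ.< B → 0ℚ ℚ.< δ →
    ∃ λ η → 0ℚ ℚ.< η × A ℚ.* η ℚ.+ B ℚ.* η ≡ δ
  apportion {A} {B} {δ} A>0 B>0 δ>0 = divide (A ℚ.+ B) refl (ℚ.positive (ℚ.+-mono-< A>0 B>0))
    where
    divide : ∀ K → A ℚ.+ B ≡ K → ℚ.Positive K →
      ∃ λ η → 0ℚ ℚ.< η × A ℚ.* η ℚ.+ B ℚ.* η ≡ δ
    divide K A+B≡K K-pos = r ℚ.* δ , ℚ.positive⁻¹ (r ℚ.* δ) {{rδ-pos}} ,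
      trans (sym (ℚ.*-distribʳ-+ (r ℚ.* δ) A B))
        (trans (cong (ℚ._* (r ℚ.* δ)) A+B≡K)
          (trans (sym (ℚ.*-assoc K r δ))
            (trans (cong (ℚ._* δ) (ℚ.*-inverseʳ K {{K-nonZero}})) (ℚ.*-identityˡ δ))))
      where
      K-nonZero : ℚ.NonZero K
      K-nonZero = ℚ.pos⇒nonZero K {{K-pos}}
      r : ℚ
      r = (1/ K) {{K-nonZero}}
      rδ-pos : ℚ.Positive (r ℚ.* δ)
      rδ-pos = ℚ.pos*pos⇒pos r {{ℚ.1/pos⇒pos K {{K-pos}}}} δ {{ℚ.positive δ>0}}

  *-≤-bounds : ∀ {a b c d} → ∣ a ∣ ℚ.≤ c → ∣ b ∣ ℚ.≤ d → 0ℚ ℚ.< c → ∣ a ℚ.* b ∣ ℚ.≤ c ℚ.* d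
  *-≤-bounds {a} {b} {c} {d} a≤ b≤ c>0 = begin
    ∣ a ℚ.* b ∣         ≡⟨ ℚ.∣p*q∣≡∣p∣*∣q∣ a b ⟩
    ∣ a ∣ ℚ.* ∣ b ∣     ≤⟨ ℚ.*-monoʳ-≤-nonNeg ∣ b ∣ {{ℚ.nonNegative (ℚ.0≤∣p∣ b)}} a≤ ⟩
    c ℚ.* ∣ b ∣         ≤⟨ ℚ.*-monoˡ-≤-nonNeg c {{ℚ.nonNegative (ℚ.<⇒≤ c>0)}} b≤ ⟩
    c ℚ.* d             ∎
    where open ℚ.≤-Reasoning

  *-cauchy : ∀ s t → IsCauchy s → IsCauchy t → IsCauchy (λ n → s n ℚ.* t n)
  *-cauchy s t cs ct δ δ>0 =
    let A , A>0 , P , s≤A     = eventually-bounded cs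
        B , B>0 , Q , t≤B     = eventually-bounded ct
        η , η>0 , Aη+Bη≡δ     = apportion A>0 B>0 δ>0
        M , p                 = cs η η>0
        N , q                 = ct η η>0
        P⊔Q≤ : ∀ {o} → (P ℕ.⊔ Q) ℕ.⊔ (M ℕ.⊔ N) ℕ.≤ o → P ℕ.⊔ Q ℕ.≤ o
        P⊔Q≤ = ℕ.m⊔n≤o⇒m≤o (P ℕ.⊔ Q) (M ℕ.⊔ N)
        M⊔N≤ : ∀ {o} → (P ℕ.⊔ Q) ℕ.⊔ (M ℕ.⊔ N) ℕ.≤ o → M ℕ.⊔ N ℕ.≤ o
        M⊔N≤ = ℕ.m⊔n≤o⇒n≤o (P ℕ.⊔ Q) (M ℕ.⊔ N)
    in (P ℕ.⊔ Q) ℕ.⊔ (M ℕ.⊔ N) , λ m n Lm Ln → begin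
      ∣ s m ℚ.* t m ℚ.- s n ℚ.* t n ∣
        ≡⟨ cong ∣_∣ (rearrange (s m) (t m) (s n) (t n)) ⟩
      ∣ s m ℚ.* (t m ℚ.- t n) ℚ.+ t n ℚ.* (s m ℚ.- s n) ∣
        ≤⟨ ℚ.∣p+q∣≤∣p∣+∣q∣ (s m ℚ.* (t m ℚ.- t n)) (t n ℚ.* (s m ℚ.- s n)) ⟩
      ∣ s m ℚ.* (t m ℚ.- t n) ∣ ℚ.+ ∣ t n ℚ.* (s m ℚ.- s n) ∣
        ≤⟨ ℚ.+-mono-≤
             (*-≤-bounds {s m} {t m ℚ.- t n} (s≤A m (ℕ.m⊔n≤o⇒m≤o P Q (P⊔Q≤ Lm)))
               (q m n (ℕ.m⊔n≤o⇒n≤o M N (M⊔N≤ Lm)) (ℕ.m⊔n≤o⇒n≤o M N (M⊔N≤ Ln))) A>0)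
             (*-≤-bounds {t n} {s m ℚ.- s n} (t≤B n (ℕ.m⊔n≤o⇒n≤o P Q (P⊔Q≤ Ln)))
               (p m n (ℕ.m⊔n≤o⇒m≤o M N (M⊔N≤ Lm)) (ℕ.m⊔n≤o⇒m≤o M N (M⊔N≤ Ln))) B>0) ⟩
      A ℚ.* η ℚ.+ B ℚ.* η     ≡⟨ Aη+Bη≡δ ⟩
      δ                       ∎
    where
    open ℚ.≤-Reasoning
    rearrange : ∀ a b c d → a ℚ.* b ℚ.- c ℚ.* d ≡ a ℚ.* (b ℚ.- d) ℚ.+ d ℚ.* (a ℚ.- c)
    rearrange = solve 4 (λ a b c d → a :* b :- c :* d := a :* (b :- d) :+ d :* (a :- c)) refl
      where open +-*-Solver

infixl 6 _+_ _-_
infixl 7 _*_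
infixr 8 _^_
infix  4 _≤_ _<_ _≈_

fromℚ : ℚ → ℝ
fromℚ q = real (λ _ → q) (const-cauchy q)

fromℕ : ℕ → ℝ
fromℕ n = fromℚ (+ n ℚ./ 1)

0ℝ 1ℝ ½ℝ : ℝ
0ℝ = fromℚ 0ℚ
1ℝ = fromℚ 1ℚ
½ℝ = fromℚ ½

_+_ _*_ _-_ : ℝ → ℝ → ℝ
x + y = real (λ n → seq x n ℚ.+ seq y n) (+-cauchy (seq x) (seq y) (cauchy x) (cauchy y))
x * y = real (λ n → seq x n ℚ.* seq y n) (*-cauchy (seq x) (seq y) (cauchy x) (cauchy y))
x - y = real (λ n → seq x n ℚ.- seq y n) (+-cauchy (seq x) (λ n → ℚ.- seq y n) (cauchy x) (neg-cauchy (seq y) (cauchy y)))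

_^_ : ℝ → ℕ → ℝ
x ^ zero  = 1ℝ
x ^ suc n = x * x ^ n

_≤_ _<_ _≈_ : ℝ → ℝ → Set
x ≤ y = ∀ δ → 0ℚ ℚ.< δ → ∃ λ N → ∀ n → N ℕ.≤ n → seq x n ℚ.≤ seq y n ℚ.+ δ
x < y = ∃ λ δ → 0ℚ ℚ.< δ × ∃ λ N → ∀ n → N ℕ.≤ n → seq x n ℚ.+ δ ℚ.≤ seq y n
x ≈ y = x ≤ y × y ≤ x

Sum : {A : Set} → List A → (A → ℝ) → ℝ
Sum as f = foldr (λ a acc → f a + acc) 0ℝ as

-- r = t ^ e for a natural base and a positive rational exponent e = p/q:
-- r is the unique non-negative real with r ^ q = t ^ p.
IsPower : ℝ → ℕ → ℚ → Set
IsPower r t e = 0ℝ ≤ r × r ^ (↧ₙ e) ≈ fromℕ (t ℕ.^ ℤ.∣ ↥ e ∣)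

Str : Set
Str = List Bool

Language : Set₁
Language = Str → Set

Symbol : Set
Symbol = Maybe Bool          -- nothing is the blank

-- A two-way infinite tape; both lists start with the cell adjacent to the
-- head, and all cells beyond their ends are blank.
record Tape : Set where
  constructor tape
  field
    leftward  : List Symbol
    head      : Symbol
    rightward : List Symbol

data Move : Set where
  left right stay : Move

move : Move → Tape → Tape
move stay  t                   = t
move left  (tape []       h r) = tape [] nothing (h ∷ r)
move left  (tape (a ∷ l)  h r) = tape l a (h ∷ r)
move right (tape l h [])       = tape (h ∷ l) nothing []
move right (tape l h (a ∷ r))  = tape (h ∷ l) a r

writeMove : Symbol × Move → Tape → Tape
writeMove (a , m) (tape l _ r) = move m (tape l a r)

record TM : Set₁ where
  field
    workTapes : ℕ

  tapes : ℕ
  tapes = 3 ℕ.+ workTapes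

  field
    State  : Set
    size   : ℕ
    finite : State ↔ Fin size
    start  : State
    -- Either halt with a verdict or change state and act on every tape.
    δ      : State → Vec Symbol tapes → Bool ⊎ (State × Vec (Symbol × Move) tapes)

  Config : Set
  Config = State × Vec Tape tapes

  step : Config → Bool ⊎ Config
  step (q , ts) =
    map₂ (Product.map₂ (λ acts → zipWith writeMove acts ts)) (δ q (Vec.map Tape.head ts))

data _⊢_⇓[_]_ (A : TM) (c : TM.Config A) : ℕ → Bool → Set where
  halt : ∀ {b} → TM.step A c ≡ inj₁ b → A ⊢ c ⇓[ 1 ] b
  next : ∀ {c′ t b} → TM.step A c ≡ inj₂ c′ → A ⊢ c′ ⇓[ t ] b → A ⊢ c ⇓[ suc t ] b

inputTape : Str → Tape
inputTape []      = tape [] nothing []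
inputTape (b ∷ s) = tape [] (just b) (map just s)

-- The input y is on the first tape; the parameters n (in unary) and φ (its
-- code) are on the second and third.
initial : (A : TM) → Str → ℕ → Str → TM.Config A
initial A y n w =
  TM.start A ,
  inputTape y ∷ inputTape (replicate n true) ∷ inputTape w ∷
  Vec.replicate (TM.workTapes A) (inputTape [])

-- Param n x is the set of admissible (discretized) parameters φ; value φ is the
-- real number φ, and code φ its description by bits.
record Family : Set₁ where
  field
    Instance : ℕ → Str → Set
    Param    : ℕ → Str → Set
    value    : ∀ {n x} → Param n x → ℝ
    code     : ∀ {n x} → Param n x → Str
    D        : ∀ n x → Param n x → Str → ℝ

-- n ^ c + c, for varying c, bounds every polynomial.
poly : ℕ → ℕ → ℕ
poly c n = n ℕ.^ c ℕ.+ c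

record IsParameterizedFamily (𝒟 : Family) : Set where
  open Family 𝒟
  field
    -- An enumeration of S n x, of which N n x is the cardinality.
    S          : ∀ n x → Instance n x → List Str
    S-unique   : ∀ {n x} (i : Instance n x) → Unique (S n x i)
    S-spec     : ∀ {n x} (i : Instance n x) y →
                 y ∈ S n x i ⇔ (∃ λ φ → 0ℝ < D n x φ y)

  N : ∀ n x → Instance n x → ℕ
  N n x i = length (S n x i)

  field
    nonNegative   : ∀ {n x} → Instance n x → ∀ φ y → 0ℝ ≤ D n x φ y
    total         : ∀ {n x} (i : Instance n x) φ → Sum (S n x i) (D n x φ) ≈ 1ℝ
    S-length      : ∃ λ c → ∀ {n x} (i : Instance n x) {y} → y ∈ S n x i → length y ℕ.≤ poly c n
    code-length   : ∃ λ c → ∀ {n x} → Instance n x → (φ : Param n x) →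
                    length (code φ) ℕ.≤ poly c n
    code-injective : ∀ {n x} → Instance n x → Injective _≡_ _≡_ (code {n} {x})
    -- 1/N ≤ φ, with the denominator cleared.
    value-lower   : ∀ {n x} (i : Instance n x) (φ : Param n x) →
                    1ℝ ≤ fromℕ (N n x i) * value φ
    value-upper   : ∀ {n x} → Instance n x → (φ : Param n x) → value φ ≤ 1ℝ
    D-upper       : ∀ {n x} → Instance n x → ∀ φ y → D n x φ y ≤ value φ

record Decides (A : TM) (L : Language) (𝒟 : Family) : Set where
  open Family 𝒟
  field
    time    : Str → ℕ → Str → ℕ
    correct : ∀ {n x} → Instance n x → (φ : Param n x) → ∀ y →
              ∃ λ b → A ⊢ initial A y n (code φ) ⇓[ time y n (code φ) ] b × (b ≡ true ⇔ L y)

-- The exponent ε′ ranges over the positive rationals, which loses nothing: the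
-- running time is at least 1, so ε′ may always be decreased.
SmoothedPolynomial : {𝒟 : Family} → IsParameterizedFamily 𝒟 → (Str → ℕ → Str → ℕ) → Set
SmoothedPolynomial {𝒟} fam t =
  ∃ λ (ε′ : ℚ) → 0ℚ ℚ.< ε′ × ∃ λ (c : ℕ) →
  ∀ {n x} (i : Instance n x) (φ : Param n x) →
  ∃ λ (r : Str → ℝ) → (∀ y → IsPower (r y) (t y n (code φ)) ε′) ×
    Sum (S n x i) (λ y → D n x φ y * r y) ≤ fromℕ (c ℕ.* (n ℕ.* N n x i)) * value φ
  where
  open Family 𝒟
  open IsParameterizedFamily fam

SmoothedP : Language → Family → Set₁
SmoothedP L 𝒟 =
  Σ (IsParameterizedFamily 𝒟) λ fam → Σ TM λ A → Σ (Decides A L 𝒟) λ dec →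
    SmoothedPolynomial fam (Decides.time dec)

record Graph (n : ℕ) : Set where
  field
    adj       : Fin n → Fin n → Bool
    symmetric : ∀ i j → adj i j ≡ adj j i
    loopless  : ∀ i → adj i i ≡ false

-- The pairs i < j, listed by increasing j and then increasing i.
pairs : ∀ n → List (Fin n × Fin n)
pairs n = concatMap (λ j → map (λ i → inject i , j) (allFin (toℕ j))) (allFin n)

encode : ∀ {n} → Graph n → Str
encode {n} G = map (λ (i , j) → Graph.adj G i j) (pairs n)

Colorable : ℕ → ∀ {n} → Graph n → Set
Colorable k {n} G = ∃ λ (c : Fin n → Fin k) → ∀ i j → T (Graph.adj G i j) → c i ≢ c j

-- Graphs have at least one vertex; the number of vertices is then determined by
-- the length of the encoding.
GraphCode : ℕ → Str → Set
GraphCode n x = NonZero n × ∃ λ (G : Graph n) → encode G ≡ x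

kColoring : ℕ → Language
kColoring k y = ∃ λ n → NonZero n × ∃ λ (G : Graph n) → encode G ≡ y × Colorable k G

-- The probability that flipping each bit of the first string independently with
-- probability ε yields the second one.
flipProb : ℝ → Str → Str → ℝ
flipProb ε []      []      = 1ℝ
flipProb ε (a ∷ x) (b ∷ y) with a Bool.≟ b
... | yes _ = (1ℝ - ε) * flipProb ε x y
... | no  _ = ε * flipProb ε x y
flipProb ε _       _       = 0ℝ

-- An arbitrary choice of the discretized parameter values for each n, together
-- with the flip probability ε that each of them determines.
record Discretization : Set₁ where
  field
    Param          : ℕ → Set
    code           : ∀ {n} → Param n → Str
    code-injective : ∀ {n} → Injective _≡_ _≡_ (code {n})
    code-length    : ∃ λ c → ∀ {n} (p : Param n) → length (code p) ℕ.≤ poly c n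
    φ ε            : ∀ {n} → Param n → ℝ
    φ-lower        : ∀ {n} (p : Param n) → ½ℝ ^ (n C 2) ≤ φ p
    φ-upper        : ∀ {n} (p : Param n) → φ p ≤ 1ℝ
    ε-lower        : ∀ {n} (p : Param n) → 0ℝ ≤ ε p
    ε-upper        : ∀ {n} (p : Param n) → ε p ≤ ½ℝ
    ε-spec         : ∀ {n} (p : Param n) → (1ℝ - ε p) ^ (n C 2) ≈ φ p
    -- Some value of the parameter really flips edges; otherwise the graphs of
    -- positive probability would not be all 2 ^ (n C 2) ones.
    nondegenerate  : ∀ n → ∃ λ (p : Param n) → 0ℝ < ε p

smoothedGnp : Discretization → Family
smoothedGnp disc = record
  { Instance = GraphCode
  ; Param    = λ n _ → Param n
  ; value    = φ
  ; code     = code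
  ; D        = λ n x p y → flipProb (ε p) x y
  }
  where open Discretization disc

{-# OPTIONS --safe #-}

-- The machine colours the vertices one after the other by backtracking, reading
-- the column of a vertex (its adjacencies to the earlier ones) only when it is
-- reached. A partial colouring with class sizes s_a is proper for a fraction
-- 2 ^ - Σ_a s_a (s_a - 1) / 2 of the graphs, which beats the number k ^ j of
-- colourings of j vertices; so the running time, averaged over all strings of
-- length n C 2, is bounded by a constant depending only on k. This is proved by
-- induction on the search tree with the potential
-- Q = Π_a 2 ^ ((s_a - L) (s_a - L - 1) / 2): on average, each colour of the next
-- vertex contributes exactly Q / 2 ^ L, and L is fixed with 4 k ≤ 2 ^ L.
-- Since every string has probability at most φ, the expected running time is at
-- most φ times the sum of all running times, that is O(N φ), and the exponent
-- ε′ = 1 is good enough.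

module Submission where

open import Defs hiding (_+_; _-_; _*_; _^_; _≤_; _<_; _≈_)
import Defs as R
open import Data.Bool using (Bool; true; false; _∧_; _∨_; if_then_else_; T)
import Data.Bool.Properties as Bool
open import Data.Bool.Properties using (∨-assoc; ∨-comm; ∨-identityʳ; T-≡)
open import Data.Empty using (⊥; ⊥-elim)
open import Data.Fin as Fin using (Fin; zero; suc; toℕ; inject₁; fromℕ<)
import Data.Fin.Properties as Fin
open import Data.Fin.Properties
  using (+↔⊎; *↔×; 2↔Bool; toℕ<n; toℕ-inject; toℕ-inject₁; toℕ-fromℕ<; toℕ-injective; toℕ≤pred[n])
import Data.Integer as ℤ
import Data.Integer.Properties as ℤ
open import Data.List hiding (lookup; zipWith; sum)
open import Data.List.Properties hiding (sum-++)
open import Data.List.Membership.Propositional using (_∈_; lose)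
open import Data.List.Membership.Propositional.Properties using (∈-++⁺ˡ; ∈-++⁺ʳ; ∈-++⁻; ∈-map⁺; ∈-map⁻)
import Data.List.Relation.Unary.All as All
open import Data.List.Relation.Unary.AllPairs using ([]; _∷_)
open import Data.List.Relation.Unary.Any using (Any; here; there; satisfied)
open import Data.List.Relation.Unary.Unique.Propositional using (Unique)
import Data.List.Relation.Unary.Unique.Propositional.Properties as Unique
open import Data.Maybe as Maybe using (Maybe; just; nothing)
open import Data.Nat using (ℕ; zero; suc; _+_; _*_; _∸_; _^_; _⊔_; _≤_; _<_; _<ᵇ_; z≤n; s≤s; >-nonZero⁻¹)
open import Data.Nat.Combinatorics using (_C_; nC1≡n; nCk+nC[k+1]≡[n+1]C[k+1])
import Data.Nat.Coprimality as Coprimality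
open import Data.Nat.ListAction using (sum)
open import Data.Nat.ListAction.Properties using (sum-++)
open import Data.Nat.Properties renaming (_≟_ to _≟ℕ_)
open import Data.Nat.Tactic.RingSolver using (solve-∀)
open import Data.Product using (∃; _×_; _,_; proj₁; proj₂)
open import Data.Product.Function.NonDependent.Propositional using (_×-↔_)
open import Data.Rational as ℚ using (ℚ; 0ℚ; 1ℚ; ½; ∣_∣; mkℚ)
import Data.Rational.Properties as ℚ
open import Data.Rational.Solver using (module +-*-Solver)
open import Data.Sum as Sum using (_⊎_; inj₁; inj₂)
open import Data.Sum.Function.Propositional using (_⊎-↔_)
open import Data.Vec as Vec using (Vec; []; _∷_)
import Data.Vec.Properties as Vec
open import Function using (_∘_; id; _∋_; _↔_; _⇔_; mk⇔; Equivalence)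
import Function.Properties.Equivalence as ⇔
open import Function.Properties.Inverse using (↔-sym; ↔-refl; ↔-trans)
open import Relation.Binary.Definitions using (tri<; tri≈; tri>)
open import Relation.Binary.PropositionalEquality
open import Relation.Nullary using (¬_; yes; no; does)

-- While the colour classes are small, a column excludes few colours and the tree may still grow;
-- only later does it shrink. A bound that treats all partial colourings alike does not survive the
-- induction. The potential starts high and falls while classes are smaller than `L`, which pays for
-- the early growth; its exponents are natural numbers, so it is at least 1 and also covers the
-- steps spent at the node itself. What is averaged is not the running time but `cost`, which also
-- charges branches after a success: as a plain sum over colours it can be averaged column by
-- column. The verdict has to be right on every string, also on one that encodes no graph. The
-- machine does not compute the number of vertices: it accepts only where a column ends together
-- with the input, so the search itself detects malformed strings.

private variable
  A B : Set

-- Tapes as infinite sequences of cells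

Cells : Set → Set
Cells A = List (Maybe A)

-- The second list starts with the cell under the head.
Zipper : Set → Set
Zipper A = Cells A × Cells A

module _ {A : Set} where

  cell : Cells A → ℕ → Maybe A
  cell []       _       = nothing
  cell (x ∷ _)  zero    = x
  cell (_ ∷ xs) (suc i) = cell xs i

  focus : Zipper A → Maybe A
  focus (l , r) = cell r 0

  beyond : Cells A → Cells A
  beyond []       = []
  beyond (_ ∷ xs) = xs

  shift : Move → Zipper A → Zipper A
  shift stay  z       = z
  shift left  (l , r) = beyond l , cell l 0 ∷ r
  shift right (l , r) = cell r 0 ∷ l , beyond r

  put : Maybe (Maybe A) → Zipper A → Zipper A
  put nothing  z       = z
  put (just s) (l , r) = l , s ∷ beyond r

  cell-beyond : ∀ xs i → cell (beyond xs) i ≡ cell xs (suc i)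
  cell-beyond []       i = refl
  cell-beyond (_ ∷ xs) i = refl

  infix 4 _≗ᶜ_
  _≗ᶜ_ : Cells A → Cells A → Set
  xs ≗ᶜ ys = ∀ i → cell xs i ≡ cell ys i

  blank≗[] : nothing ∷ [] ≗ᶜ []
  blank≗[] zero    = refl
  blank≗[] (suc i) = refl

  -- A step left followed by a step right restores the contents only up to a blank, which becomes
  -- explicit at the end of `xs`.
  unshift : ∀ xs → cell xs 0 ∷ beyond xs ≗ᶜ xs
  unshift []       = blank≗[]
  unshift (x ∷ xs) = λ _ → refl

  ∷-cong-≗ : ∀ x {xs ys} → xs ≗ᶜ ys → x ∷ xs ≗ᶜ x ∷ ys
  ∷-cong-≗ x e zero    = refl
  ∷-cong-≗ x e (suc i) = e i

-- The tape t shows the contents z, each symbol being written as code s; the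
-- blanks that the machine leaves at the ends of the lists of t do not matter.
record Shows {A : Set} (code : Maybe A → Symbol) (t : Tape) (z : Zipper A) : Set where
  constructor shows
  field
    before : ∀ i → cell (Tape.leftward t) i ≡ code (cell (proj₁ z) i)
    after  : ∀ i → cell (Tape.head t ∷ Tape.rightward t) i ≡ code (cell (proj₂ z) i)
open Shows

written : {A : Set} → (Maybe A → Symbol) → Maybe (Maybe A) → Symbol → Symbol
written code nothing  h = h
written code (just s) h = code s

module _ {A : Set} (code : Maybe A → Symbol) (code-blank : code nothing ≡ nothing) where

  shows-resp : ∀ {t l l′ r r′} → l ≗ᶜ l′ → r ≗ᶜ r′ → Shows code t (l , r) → Shows code t (l′ , r′)
  shows-resp l≗ r≗ (shows p q) = shows
    (λ i → trans (p i) (cong code (l≗ i))) (λ i → trans (q i) (cong code (r≗ i)))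

  shows-move : ∀ m t z → Shows code t z → Shows code (move m t) (shift m z)
  shows-move stay  t                    z       s       = s
  shows-move left  (tape [] h r)        (L , R) (shows p q) = shows
    (λ i → trans (p (suc i)) (cong code (sym (cell-beyond L i))))
    λ { zero → p 0 ; (suc i) → q i }
  shows-move left  (tape (a ∷ l) h r)   (L , R) (shows p q) = shows
    (λ i → trans (p (suc i)) (cong code (sym (cell-beyond L i))))
    λ { zero → p 0 ; (suc i) → q i }
  shows-move right (tape l h [])        (L , R) (shows p q) = shows
    (λ { zero → q 0 ; (suc i) → p i })
    λ i → trans (blank≗[] i) (trans (q (suc i)) (cong code (sym (cell-beyond R i))))
  shows-move right (tape l h (a ∷ r))   (L , R) (shows p q) = shows
    (λ { zero → q 0 ; (suc i) → p i })
    λ i → trans (q (suc i)) (cong code (sym (cell-beyond R i)))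

  shows-writeMove : ∀ w m t z → Shows code t z →
    Shows code (writeMove (written code w (Tape.head t) , m) t) (shift m (put w z))
  shows-writeMove nothing  m t            z       s       = shows-move m t z s
  shows-writeMove (just s) m (tape l h r) (L , R) (shows p q) =
    shows-move m (tape l (code s) r) (L , s ∷ beyond R)
      (shows p λ { zero → refl ; (suc i) → trans (q (suc i)) (cong code (sym (cell-beyond R i))) })

length-∷ʳ : ∀ {A : Set} (x : A) xs → length (xs ∷ʳ x) ≡ suc (length xs)
length-∷ʳ x xs = trans (length-++ xs) (+-comm (length xs) 1)

cells : ∀ {A : Set} → List A → Cells A
cells = map just

-- The backtracking machine

module _ {k : ℕ} where

  clash : Fin k → List (Fin k) → Str → Bool
  clash a (x ∷ xs) (b ∷ bs) = (b ∧ does (a Fin.≟ x)) ∨ clash a xs bs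
  clash a _        _        = false

  -- Ext xs vs: the colouring xs of the first vertices extends to all vertices
  -- of a graph whose remaining adjacency columns are vs.
  data Ext : List (Fin k) → Str → Set where
    done : ∀ {x xs} → Ext (x ∷ xs) []
    more : ∀ {xs vs} → length xs ≤ length vs → ∀ a → clash a xs (take (length xs) vs) ≡ false →
           Ext (xs ∷ʳ a) (drop (length xs) vs) → Ext xs vs

  -- Colours are written one-hot on k parallel work tapes, one for each colour a.
  onehot : Fin k → Maybe (Fin k) → Symbol
  onehot a nothing  = nothing
  onehot a (just c) = just (does (a Fin.≟ c))

hot : ∀ {k} → Vec Symbol k → Maybe (Fin k)
hot []              = nothing
hot (just true ∷ _) = just zero
hot (_ ∷ v)         = Maybe.map suc (hot v)

hot-onehot : ∀ {k} (s : Maybe (Fin k)) → hot (Vec.tabulate (λ a → onehot a s)) ≡ s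
hot-onehot {zero}  nothing        = refl
hot-onehot {suc k} nothing        = cong (Maybe.map suc) (hot-onehot {k} nothing)
hot-onehot {suc k} (just zero)    = refl
hot-onehot {suc k} (just (suc c)) = cong (Maybe.map suc) (hot-onehot (just c))

lower : ∀ {k} → Fin k → Maybe (Fin k)
lower zero    = nothing
lower (suc a) = just (inject₁ a)

first : ∀ k → Maybe (Fin k)
first zero    = nothing
first (suc k) = just (Fin.fromℕ k)

-- Colours are tried in decreasing order: as lists those tried from a given one on.
data Queue {k} : Maybe (Fin k) → List (Fin k) → Set where
  empty : Queue nothing []
  cons  : ∀ {a as} → Queue (lower a) as → Queue (just a) (a ∷ as)

-- The recursion is on `m` because `inject₁ a` is not a subterm of `suc a`. The length later enters
-- the average cost, and the last component makes the search complete.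
queueBelow : ∀ {k} m (a : Fin k) → toℕ a ≡ m →
  ∃ λ as → Queue (just a) as × length as ≡ suc m × (∀ b → toℕ b ≤ m → b ∈ as)
queueBelow zero    zero    refl = zero ∷ [] , cons empty , refl , λ { zero _ → here refl }
queueBelow (suc m) (suc a) eq
  with queueBelow m (inject₁ a) (trans (toℕ-inject₁ a) (suc-injective eq))
... | as , q , len , all = suc a ∷ as , cons q , cong suc len , all′
  where
  all′ : ∀ b → toℕ b ≤ suc m → b ∈ suc a ∷ as
  all′ b b≤ with m≤n⇒m<n∨m≡n b≤
  ... | inj₁ (s≤s b≤m) = there (all b b≤m)
  ... | inj₂ b≡        = here (Fin.toℕ-injective (trans b≡ (sym eq)))

allColours : ∀ k → ∃ λ as → Queue (first k) as × length as ≡ k × (∀ b → b ∈ as)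
allColours zero    = [] , empty , refl , λ ()
allColours (suc k) with queueBelow k (Fin.fromℕ k) (Fin.toℕ-fromℕ k)
... | as , q , len , all = as , q , len , λ b → all b (toℕ≤pred[n] b)

-- The total length of the adjacency columns of the r vertices from vertex j on.
width : ℕ → ℕ → ℕ
width j zero    = 0
width j (suc r) = j + width (suc j) r

module Machine (k : ℕ) where

  -- The colours of the vertices coloured so far are on the work tapes; the work
  -- heads and the input head move in step over a colouring and a column.
  --   enter     start of the column of the next vertex; accept if the input is over
  --   scan f a  compare the column with the colours; f: colour a is already in conflict
  --   rewind a  back to the start of the column in order to scan for colour a
  --   home      colour found: work heads back to the first vertex, then enter
  --   giveUp    no colour left: both heads back to the start of the column
  --   seek, pop work heads to the last vertex, to erase its colour and try the next one
  State : Set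
  State = Fin 5 ⊎ (Bool × Fin k ⊎ Fin k)

  pattern enter    = inj₁ zero
  pattern home     = inj₁ (suc zero)
  pattern giveUp   = inj₁ (suc (suc zero))
  pattern seek     = inj₁ (suc (suc (suc zero)))
  pattern pop      = inj₁ (suc (suc (suc (suc zero))))
  pattern scan f a = inj₂ (inj₁ (f , a))
  pattern rewind a = inj₂ (inj₂ a)

  finite : State ↔ Fin (5 + (2 * k + k))
  finite = ↔-sym (↔-trans (+↔⊎ {5})
    (↔-refl ⊎-↔ ↔-trans (+↔⊎ {2 * k}) (↔-trans (*↔× {2}) (2↔Bool ×-↔ ↔-refl) ⊎-↔ ↔-refl)))

  retry : Maybe (Fin k) → State
  retry nothing  = giveUp
  retry (just a) = rewind a

  -- New state, moves of the input head and of the k work heads, and the colour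
  -- (or blank) written at the work heads, if any.
  Action : Set
  Action = State × Move × Move × Maybe (Maybe (Fin k))

  rule : State → Maybe (Fin k) → Symbol → Bool ⊎ Action
  rule enter      (just _) nothing  = inj₁ true
  rule enter      (just _) (just _) = inj₂ (retry (first k) , left , left , nothing)
  -- No vertex is coloured yet, so even an empty input is no success: the empty string encodes the
  -- graph with one vertex, which still needs a colour.
  rule enter      nothing  _        = inj₂ (retry (first k) , left , left , nothing)
  rule (scan f a) (just c) (just b) = inj₂ (scan (f ∨ (b ∧ does (a Fin.≟ c))) a , right , right , nothing)
  -- The input ends inside a column, and no other colour can change that.
  rule (scan f a) (just _) nothing  = inj₂ (giveUp , left , left , nothing)
  rule (scan false a) nothing _     = inj₂ (home , stay , left , just (just a))
  rule (scan true a)  nothing _     = inj₂ (retry (lower a) , left , left , nothing)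
  rule (rewind a) (just _) _        = inj₂ (rewind a , left , left , nothing)
  rule (rewind a) nothing  _        = inj₂ (scan false a , right , right , nothing)
  rule home       (just _) _        = inj₂ (home , stay , left , nothing)
  rule home       nothing  _        = inj₂ (enter , stay , right , nothing)
  rule giveUp     (just _) _        = inj₂ (giveUp , left , left , nothing)
  rule giveUp     nothing  _        = inj₂ (seek , stay , right , nothing)
  rule seek       (just _) _        = inj₂ (seek , stay , right , nothing)
  rule seek       nothing  _        = inj₂ (pop , stay , left , nothing)
  rule pop        (just a) _        = inj₂ (retry (lower a) , stay , left , just nothing)
  rule pop        nothing  _        = inj₁ false

  act : Symbol → Symbol → Symbol → Vec Symbol k → Action → State × Vec (Symbol × Move) (3 + k)
  act i u v ws (q , mi , mw , w) =
    q , (i , mi) ∷ (u , stay) ∷ (v , stay) ∷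
        Vec.tabulate (λ a → written (onehot a) w (Vec.lookup ws a) , mw)

  searcher : TM
  searcher = record
    { workTapes = k
    ; State     = State
    ; size      = _
    ; finite    = finite
    ; start     = enter
    ; δ         = λ { q (i ∷ u ∷ v ∷ ws) → Sum.map₂ (act i u v ws) (rule q (hot ws) i) }
    }

  -- Runs of the machine on idealised tapes

  record ShowsWork (ws : Vec Tape k) (W : Zipper (Fin k)) : Set where
    constructor showsWork
    field
      track : ∀ a → Shows (onehot a) (Vec.lookup ws a) W
  open ShowsWork

  -- Halts within t steps. Runs are composed backwards: the lemmas below derive
  -- Halts of a configuration from Halts of a later one.
  Halts : State → Zipper Bool → Zipper (Fin k) → ℕ → Bool → Set
  Halts q I W t b = ∀ {i u v ws} → Shows id i I → ShowsWork ws W →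
    ∃ λ s → s ≤ t × searcher ⊢ (q , i ∷ u ∷ v ∷ ws) ⇓[ s ] b

  hot-heads : ∀ ws W → ShowsWork ws W → hot (Vec.map Tape.head ws) ≡ focus W
  hot-heads ws W sw = trans (cong hot (trans (sym (Vec.tabulate∘lookup (Vec.map Tape.head ws))) (Vec.tabulate-cong λ a →
    trans (Vec.lookup-map a Tape.head ws) (after (track sw a) 0)))) (hot-onehot (focus W))

  step-with : ∀ {q I W i u v ws r} → Shows id i I → ShowsWork ws W → rule q (focus W) (focus I) ≡ r →
    TM.step searcher (q , i ∷ u ∷ v ∷ ws) ≡
    Sum.map₂ (λ { (q′ , as) → q′ , Vec.zipWith writeMove as (i ∷ u ∷ v ∷ ws) })
      (Sum.map₂ (act (Tape.head i) (Tape.head u) (Tape.head v) (Vec.map Tape.head ws)) r)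
  step-with {q} {I} {W} {ws = ws} si sw refl rewrite hot-heads ws W sw | after si 0 = refl

  verdict : ∀ {q I W b} → rule q (focus W) (focus I) ≡ inj₁ b → Halts q I W 1 b
  verdict {I = I} {W} e {i} {ws = ws} si sw = 1 , ≤-refl , halt (step-with {I = I} {W} {i} {ws = ws} si sw e)

  step : ∀ {q I W q′ mi mw w t b} → rule q (focus W) (focus I) ≡ inj₂ (q′ , mi , mw , w) →
    Halts q′ (shift mi I) (shift mw (put w W)) t b → Halts q I W (suc t) b
  step {I = I} {W} {mi = mi} {mw} {w} e h {i} {u} {v} {ws} si sw
    with h {move mi i} {u} {v} {ws′} (shows-move id refl mi i I si) sw′
    where
    heads = Vec.map Tape.head ws
    acts : Vec (Symbol × Move) k
    acts = Vec.tabulate (λ a → written (onehot a) w (Vec.lookup heads a) , mw)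
    ws′ = Vec.zipWith writeMove acts ws
    sw′ : ShowsWork ws′ (shift mw (put w W))
    track sw′ a = subst (λ t → Shows (onehot a) t (shift mw (put w W)))
      (sym (trans (Vec.lookup-zipWith writeMove a acts ws)
        (cong (λ x → writeMove x (Vec.lookup ws a))
          (trans (Vec.lookup∘tabulate (λ a → written (onehot a) w (Vec.lookup heads a) , mw) a)
            (cong (λ h → written (onehot a) w h , mw) (Vec.lookup-map a Tape.head ws))))))
      (shows-writeMove (onehot a) refl w mw (Vec.lookup ws a) W (track sw a))
  ... | s , s≤ , run = suc s , s≤s s≤ , next (step-with {I = I} {W} {i} {ws = ws} si sw e) run

  within : ∀ {q I W t t′ b} → t ≤ t′ → Halts q I W t b → Halts q I W t′ b
  within t≤ h si sw with h si sw
  ... | s , s≤ , run = s , ≤-trans s≤ t≤ , run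

  reblank : ∀ {q il il′ ir wl wl′ wr wr′ t b} → il ≗ᶜ il′ → wl ≗ᶜ wl′ → wr ≗ᶜ wr′ →
    Halts q (il′ , ir) (wl′ , wr′) t b → Halts q (il , ir) (wl , wr) t b
  reblank il≗ wl≗ wr≗ h si sw =
    h (shows-resp id refl il≗ (λ _ → refl) si)
      (showsWork λ a → shows-resp (onehot a) refl wl≗ wr≗ (track sw a))

  -- One statement serves `rewind` and `giveUp`, which differ only in what they do at the blank
  -- before the first colour. `shift left` of the reversed lists means that the heads are on the
  -- last cells, and for empty lists already one cell before the start.
  rewound : ∀ {q} → (∀ c i → rule q (just c) i ≡ inj₂ (q , left , left , nothing)) →
    ∀ {us vs l r t b} xs col → length xs ≡ length col →
    Halts q (shift left (us , cells col ++ vs)) (shift left (l , cells xs ++ r)) t b →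
    Halts q (shift left (cells col ʳ++ us , vs)) (shift left (cells xs ʳ++ l , r)) (length xs + t) b
  rewound stays []       []        _  h = h
  rewound stays (x ∷ xs) (u ∷ col) eq h =
    within (≤-reflexive (+-suc (length xs) _))
      (rewound stays xs col (suc-injective eq) (step (stays x _) h))

  homing : ∀ {I l r t b} xs →
    Halts home I (shift left (l , cells xs ++ r)) t b →
    Halts home I (shift left (cells xs ʳ++ l , r)) (length xs + t) b
  homing []       h = h
  homing (x ∷ xs) h = within (≤-reflexive (+-suc (length xs) _)) (homing xs (step refl h))

  seeking : ∀ {I l t b} xs → Halts seek I (cells xs ʳ++ l , []) t b →
    Halts seek I (l , cells xs) (length xs + t) b
  seeking []       h = h
  seeking (x ∷ xs) h = step refl (seeking xs h)

  scanning : ∀ {f a us vs l r t b} xs col → length xs ≡ length col →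
    Halts (scan (f ∨ clash a xs col) a) (cells col ʳ++ us , vs) (cells xs ʳ++ l , r) t b →
    Halts (scan f a) (us , cells col ++ vs) (l , cells xs ++ r) (length xs + t) b
  scanning {f} {a} []       []        _  h = subst (λ g → Halts (scan g a) _ _ _ _) (∨-identityʳ f) h
  scanning {f} {a} (x ∷ xs) (u ∷ col) eq h =
    step refl (scanning xs col (suc-injective eq)
      (subst (λ g → Halts (scan g a) _ _ _ _) (sym (∨-assoc f (u ∧ does (a Fin.≟ x)) (clash a xs col))) h))

  launch : ∀ {a us vs xs t b} → Halts (scan false a) (us , vs) ([] , xs) t b →
    Halts (rewind a) (shift left (us , vs)) ([] , nothing ∷ xs) (suc t) b
  launch {us = us} h = step refl (reblank (unshift us) blank≗[] (λ _ → refl) h)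

  retry-stays : ∀ q c i → rule (retry q) (just c) i ≡ inj₂ (retry q , left , left , nothing)
  retry-stays nothing  c i = refl
  retry-stays (just a) c i = refl

  module _ {us vs : Cells Bool} (xs : List (Fin k)) (col : Str) (len : length xs ≡ length col) where

    -- Every failed attempt at a colour returns here, so that attempts can be chained. The input
    -- head is one cell before `col`, which is also where the search for the previous vertex resumes
    -- after `pop`.
    start : Zipper Bool × Zipper (Fin k)
    start = shift left (us , cells col ++ vs) , ([] , nothing ∷ cells xs)

    private
      HaltsAtStart : State → ℕ → Bool → Set
      HaltsAtStart q = Halts q (proj₁ start) (proj₂ start)

      j : ℕ
      j = length xs

    scanned : ∀ a {t b} → Halts (scan (clash a xs col) a) (cells col ʳ++ us , vs) (cells xs ʳ++ [] , []) t b →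
      HaltsAtStart (rewind a) (suc (j + t)) b
    scanned a {t} {b} h =
      launch {us = us} (subst (λ c → Halts (scan false a) (us , cells col ++ vs) ([] , c) (j + t) b)
        (++-identityʳ (cells xs)) (scanning xs col len h))

    backAtStart : ∀ q {t b} → HaltsAtStart (retry q) t b →
      Halts (retry q) (shift left (cells col ʳ++ us , vs)) (shift left (cells xs ʳ++ [] , [])) (j + t) b
    backAtStart q {t} {b} h = rewound (retry-stays q) xs col len
      (subst (λ c → Halts (retry q) (proj₁ start) ([] , nothing ∷ c) t b) (sym (++-identityʳ (cells xs))) h)

    reject : ∀ {a t b} → clash a xs col ≡ true → HaltsAtStart (retry (lower a)) t b →
      HaltsAtStart (rewind a) (suc (j + suc (j + t))) b
    reject {a} eq h = scanned a
      (subst (λ f → Halts (scan f a) _ _ _ _) (sym eq) (step refl (backAtStart (lower a) h)))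

    accept : ∀ {a t b} → clash a xs col ≡ false →
      Halts enter (cells col ʳ++ us , vs) ([] , cells (xs ∷ʳ a)) t b →
      HaltsAtStart (rewind a) (suc (j + suc (j + suc t))) b
    accept {a} {t} {b} eq h = scanned a
      (subst (λ f → Halts (scan f a) _ _ _ _) (sym eq) (step refl (homing xs (step refl
        (reblank (λ _ → refl) blank≗[] (λ _ → refl)
          (subst (λ c → Halts enter _ ([] , c) t b) (map-++ just xs (a ∷ [])) h))))))

    -- The failed search leaves the input head at the end of `col`; erasing `a` puts the work heads
    -- on the last colour of `xs`. As `xs` and `col` have the same length, the heads are aligned
    -- again and rewinding brings both to `start`.
    return : ∀ {a t b} → HaltsAtStart (retry (lower a)) t b →
      Halts giveUp (shift left (cells col ʳ++ us , vs)) ([] , nothing ∷ cells (xs ∷ʳ a))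
        (suc (suc j + suc (suc (j + t)))) b
    return {a} {t} {b} h = step refl (reblank (λ _ → refl) blank≗[] (λ _ → refl)
      (subst (λ m → Halts seek I ([] , cells (xs ∷ʳ a)) (m + suc (suc (j + t))) b) (length-∷ʳ a xs)
        (seeking (xs ∷ʳ a)
          (subst (λ l → Halts seek I (l , []) (suc (suc (j + t))) b) (sym atEnd)
            (step refl (step refl
              (reblank (λ _ → refl) (λ _ → refl) (∷-cong-≗ _ blank≗[]) (backAtStart (lower a) h))))))))
      where
      I : Zipper Bool
      I = shift left (cells col ʳ++ us , vs)
      atEnd : cells (xs ∷ʳ a) ʳ++ [] ≡ just a ∷ (cells xs ʳ++ [])
      atEnd = trans (cong (_ʳ++ []) (map-++ just xs (a ∷ []))) (++-ʳ++ (cells xs))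

  -- `ys` is the part of the colouring scanned before the input ends. All heads turn back there,
  -- having moved equally far.
  tooShort : ∀ {a us} ys z zs vs → length ys ≡ length vs → ∀ {t b} →
    Halts giveUp (shift left (us , cells vs)) ([] , nothing ∷ cells (ys ++ z ∷ zs)) t b →
    Halts (rewind a) (shift left (us , cells vs)) ([] , nothing ∷ cells (ys ++ z ∷ zs))
      (suc (length ys + suc (length ys + t))) b
  tooShort {us = us} ys z zs vs len h rewrite map-++ just ys (z ∷ zs) | sym (++-identityʳ (cells vs)) =
    launch {us = us} (scanning ys vs len (step refl (rewound (λ _ _ → refl) ys vs len h)))

  -- A search for P accepts if P holds, and otherwise arrives in state giveUp at the
  -- configuration (I′ , W′), from where the machine backtracks.
  Outcome : Set → State → Zipper Bool × Zipper (Fin k) → Zipper Bool × Zipper (Fin k) → ℕ → Set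
  Outcome P q (I , W) (I′ , W′) n =
    P × Halts q I W n true ⊎
    ¬ P × (∀ {t b} → Halts giveUp I′ W′ t b → Halts q I W (n + t) b)

  -- 4 j + 7 steps scan a column for one colour, enter the next vertex and return
  -- from it; c is the cost of the search below that vertex.
  branchCost : ℕ → Bool → ℕ → ℕ
  branchCost j f c = 4 * j + 7 + (if f then 0 else c)

  rejectCost : ∀ j n → suc (j + suc (j + n)) ≤ 4 * j + 7 + 0 + n
  rejectCost j n = subst (suc (j + suc (j + n)) ≤_) (lemma j n) (m≤m+n _ (2 * j + 5))
    where
    lemma : ∀ j n → suc (j + suc (j + n)) + (2 * j + 5) ≡ 4 * j + 7 + 0 + n
    lemma = solve-∀

  -- The tight case, which fixes `4 * j + 7`: scanning, homing, seeking and rewinding each pass over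
  -- `j` cells, and seven further steps remain.
  acceptCost : ∀ j c n → suc (j + suc (j + suc (c + suc (suc j + suc (suc (j + n)))))) ≤ 4 * j + 7 + c + n
  acceptCost j c n = ≤-reflexive (lemma j c n)
    where
    lemma : ∀ j c n → suc (j + suc (j + suc (c + suc (suc j + suc (suc (j + n)))))) ≡ 4 * j + 7 + c + n
    lemma = solve-∀

  foundCost : ∀ j c n → suc (j + suc (j + suc c)) ≤ 4 * j + 7 + c + n
  foundCost j c n = subst (suc (j + suc (j + suc c)) ≤_) (lemma j c n) (m≤m+n _ (2 * j + 4 + n))
    where
    lemma : ∀ j c n → suc (j + suc (j + suc c)) + (2 * j + 4 + n) ≡ 4 * j + 7 + c + n
    lemma = solve-∀

  regroup : ∀ x s t {m} → m ≤ x + (s + t) → m ≤ x + s + t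
  regroup x s t {m} = subst (m ≤_) (sym (+-assoc x s t))

  entrance exit : Cells Bool × Cells Bool → List (Fin k) → Zipper Bool × Zipper (Fin k)
  entrance I xs = I , ([] , cells xs)
  exit     I xs = shift left I , ([] , nothing ∷ cells xs)

  module _ {us vs : Cells Bool} (xs : List (Fin k)) (col : Str) (len : length xs ≡ length col)
           (P : Fin k → Set) (κ : Fin k → ℕ)
           (child : ∀ a → clash a xs col ≡ false →
             Outcome (P a) enter (entrance (cells col ʳ++ us , vs) (xs ∷ʳ a))
                                 (exit (cells col ʳ++ us , vs) (xs ∷ʳ a)) (κ a))
    where

    private
      j = length xs
      here₀ : Zipper Bool × Zipper (Fin k)
      here₀ = exit (us , cells col ++ vs) xs

    -- Being abstract in `P` and `κ`, this separates the induction on the colours from the one on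
    -- the depth of the tree. The rest of the queue starts where a failed attempt ends.
    loop : ∀ {q as} → Queue q as →
      Outcome (Any (λ a → clash a xs col ≡ false × P a) as) (retry q) here₀ here₀
        (sum (map (λ a → branchCost j (clash a xs col) (κ a)) as))
    loop empty = inj₂ ((λ ()) , λ h → h)
    loop (cons {a} {as} q) with clash a xs col in eq | loop q
    ... | true | inj₁ (p , h) = inj₁ (there p , within (rejectCost j _) (reject {us} xs col len eq h))
    ... | true | inj₂ (¬p , f) = inj₂ (¬p′ , λ {t} h →
            within (regroup (branchCost j true 0) _ t (rejectCost j _)) (reject {us} xs col len eq (f h)))
      where
      ¬p′ : ¬ Any (λ a → clash a xs col ≡ false × P a) (a ∷ as)
      ¬p′ (here (eq′ , _)) with () ← trans (sym eq) eq′
      ¬p′ (there p) = ¬p p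
    ... | false | l with child a eq
    ... | inj₁ (p , h) = inj₁ (here (eq , p) , within (foundCost j (κ a) _) (accept xs col len eq h))
    ... | inj₂ (¬p , f) with l
    ... | inj₁ (p , h) = inj₁ (there p ,
            within (acceptCost j (κ a) _) (accept xs col len eq (f (return xs col len h))))
    ... | inj₂ (¬p′ , g) = inj₂ ((λ { (here (_ , p)) → ¬p p ; (there p) → ¬p′ p }) ,
            λ {t} h → within (regroup (branchCost j false (κ a)) _ t (acceptCost j (κ a) _))
              (accept xs col len eq (f (return xs col len (g h)))))

  -- The search tree and its cost

  colours : List (Fin k)
  colours = proj₁ (allColours k)

  colours-queue : Queue (first k) colours
  colours-queue = proj₁ (proj₂ (allColours k))

  -- r bounds the number of remaining columns.
  cost : ℕ → List (Fin k) → Str → ℕ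
  cost zero    xs vs = 1
  cost (suc r) xs vs = suc (sum (map
    (λ a → branchCost (length xs) (clash a xs (take (length xs) vs)) (cost r (xs ∷ʳ a) (drop (length xs) vs)))
    colours))

  Branch : List (Fin k) → Str → Fin k → Set
  Branch xs vs a = clash a xs (take (length xs) vs) ≡ false × Ext (xs ∷ʳ a) (drop (length xs) vs)

  -- Already the first colour runs off the input, and `giveUp` skips the others. The remaining
  -- summands are padding that gives this case the same cost as a regular node.
  malformed : ∀ {us} xs vs → length vs < length xs → (κ : Fin k → ℕ) → ∀ {q as} → Queue q as → ∀ {t b} →
    Halts giveUp (shift left (us , cells vs)) ([] , nothing ∷ cells xs) t b →
    Halts (retry q) (shift left (us , cells vs)) ([] , nothing ∷ cells xs)
      (sum (map (λ a → branchCost (length xs) (clash a xs (take (length xs) vs)) (κ a)) as) + t) b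
  malformed xs vs short κ empty h = h
  malformed {us} xs vs short κ (cons {a} {as} q) {t} {b} h = within enough (split (drop m xs) refl)
    where
    m = length vs
    j = length xs
    S = sum (map (λ a → branchCost j (clash a xs (take j vs)) (κ a)) as)
    len : length (take m xs) ≡ m
    len = trans (length-take m xs) (m≤n⇒m⊓n≡m (<⇒≤ short))
    X = if clash a xs (take j vs) then 0 else κ a
    I = shift left (us , cells vs)
    enough : suc (m + suc (m + t)) ≤ 4 * j + 7 + X + S + t
    enough = ≤-trans (s≤s (+-mono-≤ (<⇒≤ short) (s≤s (+-monoˡ-≤ t (<⇒≤ short)))))
      (subst (suc (j + suc (j + t)) ≤_) (lemma j X S t) (m≤m+n _ (2 * j + 5 + X + S)))
      where
      lemma : ∀ j x s t → suc (j + suc (j + t)) + (2 * j + 5 + x + s) ≡ 4 * j + 7 + x + s + t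
      lemma = solve-∀
    split : ∀ zs → drop m xs ≡ zs →
      Halts (rewind a) (shift left (us , cells vs)) ([] , nothing ∷ cells xs) (suc (m + suc (m + t))) b
    split []       eq = ⊥-elim (<⇒≢ (m<n⇒0<n∸m short) (sym (trans (sym (length-drop m xs)) (cong length eq))))
    split (z ∷ zs) eq =
      subst (λ n → Halts (rewind a) I ([] , nothing ∷ cells xs) (suc (n + suc (n + t))) b) len
        (subst (λ w → Halts (rewind a) I ([] , nothing ∷ cells w) _ b) xs-split
          (tooShort {us = us} (take m xs) z zs vs len
            (subst (λ w → Halts giveUp I ([] , nothing ∷ cells w) t b) (sym xs-split) h)))
      where
      xs-split : take m xs ++ z ∷ zs ≡ xs
      xs-split = trans (cong (take m xs ++_) (sym eq)) (take++drop≡id m xs)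

  -- The hypothesis excludes `done`, where `enter` would accept.
  branches : ∀ {xs vs r} → rule enter (cell (cells xs) 0) (cell (cells vs) 0) ≡ inj₂ r → Ext xs vs →
    length xs ≤ length vs × ∃ (Branch xs vs)
  branches () done
  branches _ (more len a ok ext) = len , a , ok , ext

  Searched : ℕ → List (Fin k) → Cells Bool → Str → Set
  Searched r xs us vs =
    Outcome (Ext xs vs) enter (entrance (us , cells vs) xs) (exit (us , cells vs) xs) (cost r xs vs)

  -- The equation on `rule` holds by `refl` for the empty colouring and for a nonempty one with
  -- input left, but only once these cases are distinguished; as a hypothesis it lets them be
  -- treated together.
  expand : ∀ r xs us vs →
    rule enter (cell (cells xs) 0) (cell (cells vs) 0) ≡ inj₂ (retry (first k) , left , left , nothing) →
    (∀ a → length xs ≤ length vs →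
      Searched r (xs ∷ʳ a) (cells (take (length xs) vs) ʳ++ us) (drop (length xs) vs)) →
    Searched (suc r) xs us vs
  expand r xs us vs entering child with length xs ≤? length vs
  ... | no ¬len = inj₂ ((λ ext → ¬len (proj₁ (branches entering ext))) ,
          λ h → step entering (malformed {us} xs vs (≰⇒> ¬len) _ colours-queue h))
  ... | yes len = conclude
          (subst (λ c → Outcome Branching (retry (first k)) (exit (us , c) xs) (exit (us , c) xs) total) split
            (loop xs (take j vs) (sym (trans (length-take j vs) (m≤n⇒m⊓n≡m len)))
              (λ a → Ext (xs ∷ʳ a) (drop j vs)) (λ a → cost r (xs ∷ʳ a) (drop j vs))
              (λ a _ → child a len) colours-queue))
    where
    j = length xs
    Branching = Any (Branch xs vs) colours
    total : ℕ
    total = sum (map (λ a → branchCost j (clash a xs (take j vs)) (cost r (xs ∷ʳ a) (drop j vs))) colours)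
    split : cells (take j vs) ++ cells (drop j vs) ≡ cells vs
    split = trans (sym (map-++ just (take j vs) (drop j vs))) (cong cells (take++drop≡id j vs))
    some : Any (Branch xs vs) colours → Ext xs vs
    some any = let a , ok , ext = satisfied any in more len a ok ext
    every : Ext xs vs → Any (Branch xs vs) colours
    every ext with branches entering ext
    ... | _ , a , branch = lose (proj₂ (proj₂ (proj₂ (allColours k))) a) branch
    conclude : ∀ {n} → Outcome Branching (retry (first k)) (exit (us , cells vs) xs) (exit (us , cells vs) xs) n →
      Outcome (Ext xs vs) enter (entrance (us , cells vs) xs) (exit (us , cells vs) xs) (suc n)
    conclude (inj₁ (p , h))  = inj₁ (some p , step entering h)
    conclude (inj₂ (¬p , f)) = inj₂ (¬p ∘ every , λ h → step entering (f h))

  -- The first inequality makes `r` levels enough to use up the input, so at `r = 0` the input is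
  -- empty; the second then excludes the empty colouring, with which `enter` would not accept.
  search : ∀ r xs us vs → length vs ≤ width (length xs) r → 0 < length xs + r → Searched r xs us vs
  search zero    (x ∷ xs) us []       _ _ = inj₁ (done , verdict refl)
  search (suc r) (x ∷ xs) us []       _ _ = inj₁ (done , within (s≤s z≤n) (verdict refl))
  search (suc r) []       us vs       fits _ =
    expand r [] us vs refl λ a _ → search r (a ∷ []) us vs fits (s≤s z≤n)
  search (suc r) (x ∷ xs) us (v ∷ vs) fits _ =
    expand r (x ∷ xs) us (v ∷ vs) refl λ a _ →
      search r (x ∷ xs ∷ʳ a) _ (drop (length xs) vs)
        (subst₂ (λ m n → m ≤ width (suc n) r) (sym (length-drop (length xs) vs)) (sym (length-∷ʳ a xs))
          (m≤n+o⇒m∸n≤o (length vs) (length xs) (≤-pred fits)))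
        (s≤s z≤n)

  shows-input : ∀ y → Shows id (inputTape y) ([] , cells y)
  shows-input []      = shows (λ _ → refl) blank≗[]
  shows-input (b ∷ y) = shows (λ _ → refl) (λ _ → refl)

  shows-blank : ShowsWork (Vec.replicate k (inputTape [])) ([] , [])
  shows-blank = showsWork λ a → subst (λ t → Shows (onehot a) t ([] , [])) (sym (Vec.lookup-replicate a _))
    (shows (λ _ → refl) blank≗[])

  decides : ∀ r y n w → length y ≤ width 0 r → 0 < r →
    ∃ λ b → ∃ λ s → searcher ⊢ initial searcher y n w ⇓[ s ] b × (b ≡ true ⇔ Ext {k} [] y) × s ≤ cost r [] y + 3
  decides r y n w fits 0<r with search r [] [] y fits 0<r
  ... | inj₁ (ext , h) =
    let s , s≤ , run = h (shows-input y) shows-blank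
    in true , s , run , mk⇔ (λ _ → ext) (λ _ → refl) , ≤-trans s≤ (m≤m+n _ 3)
  ... | inj₂ (¬ext , h) =
    -- After the root has failed, the machine passes through `giveUp`, `seek` and `pop`: three steps
    -- on top of the cost.
    let s , s≤ , run = h (step refl (step refl (verdict refl))) (shows-input y) shows-blank
    in false , s , run , mk⇔ (λ ()) (λ ext → ⊥-elim (¬ext ext)) , s≤

-- Needed because the running time is defined through a search of depth `suc (length y)`, while the
-- average is computed for depth `n`.
⇓-functional : ∀ {A c t t′ b b′} → A ⊢ c ⇓[ t ] b → A ⊢ c ⇓[ t′ ] b′ → t ≡ t′
⇓-functional (halt _)   (halt _)    = refl
⇓-functional (halt e)   (next e′ _) with () ← trans (sym e) e′
⇓-functional (next e _) (halt e′)   with () ← trans (sym e) e′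
⇓-functional (next e r) (next e′ r′) with refl ← trans (sym e) e′ = cong suc (⇓-functional r r′)

-- The total running time over all strings of a given length

∑ : List A → (A → ℕ) → ℕ
∑ as f = sum (map f as)

∑-++ : ∀ (f : A → ℕ) as bs → ∑ (as ++ bs) f ≡ ∑ as f + ∑ bs f
∑-++ f as bs = trans (cong sum (map-++ f as bs)) (sum-++ (map f as) (map f bs))

∑-map : ∀ (f : A → ℕ) (g : B → A) bs → ∑ (map g bs) f ≡ ∑ bs (f ∘ g)
∑-map f g bs = cong sum (sym (map-∘ bs))

∑-mono : ∀ {f g : A → ℕ} as → (∀ {a} → a ∈ as → f a ≤ g a) → ∑ as f ≤ ∑ as g
∑-mono []       f≤g = z≤n
∑-mono (a ∷ as) f≤g = +-mono-≤ (f≤g (here refl)) (∑-mono as (f≤g ∘ there))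

∑-cong : ∀ {f g : A → ℕ} as → (∀ {a} → a ∈ as → f a ≡ g a) → ∑ as f ≡ ∑ as g
∑-cong as f≡g = ≤-antisym (∑-mono as (≤-reflexive ∘ f≡g)) (∑-mono as (≤-reflexive ∘ sym ∘ f≡g))

∑-const : ∀ c (as : List A) → ∑ as (λ _ → c) ≡ length as * c
∑-const c []       = refl
∑-const c (a ∷ as) = cong (c +_) (∑-const c as)

∑-+ : ∀ (f g : A → ℕ) as → ∑ as (λ a → f a + g a) ≡ ∑ as f + ∑ as g
∑-+ f g []       = refl
∑-+ f g (a ∷ as) = trans (cong (f a + g a +_) (∑-+ f g as)) (interchange (f a) (g a) (∑ as f) (∑ as g))
  where
  interchange : ∀ p q r s → p + q + (r + s) ≡ p + r + (q + s)
  interchange = solve-∀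

∑-*ˡ : ∀ c (f : A → ℕ) as → ∑ as (λ a → c * f a) ≡ c * ∑ as f
∑-*ˡ c f []       = sym (*-zeroʳ c)
∑-*ˡ c f (a ∷ as) = trans (cong (c * f a +_) (∑-*ˡ c f as)) (sym (*-distribˡ-+ c (f a) (∑ as f)))

∑-*ʳ : ∀ c (f : A → ℕ) as → ∑ as (λ a → f a * c) ≡ ∑ as f * c
∑-*ʳ c f as = trans (∑-cong as λ {a} _ → *-comm (f a) c) (trans (∑-*ˡ c f as) (*-comm c (∑ as f)))

∑-swap : ∀ (f : A → B → ℕ) as bs → ∑ as (λ a → ∑ bs (f a)) ≡ ∑ bs (λ b → ∑ as (λ a → f a b))
∑-swap f []       bs = sym (trans (∑-const 0 bs) (*-zeroʳ (length bs)))
∑-swap f (a ∷ as) bs = trans (cong (∑ bs (f a) +_) (∑-swap f as bs)) (sym (∑-+ (f a) (λ b → ∑ as (λ a → f a b)) bs))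

strings : ℕ → List Str
strings zero    = [] ∷ []
strings (suc m) = map (false ∷_) (strings m) ++ map (true ∷_) (strings m)

length-strings : ∀ m → length (strings m) ≡ 2 ^ m
length-strings zero    = refl
length-strings (suc m) = begin
  length (strings (suc m))
    ≡⟨ length-++ (map (false ∷_) (strings m)) ⟩
  length (map (false ∷_) (strings m)) + length (map (true ∷_) (strings m))
    ≡⟨ cong₂ _+_ (length-map _ (strings m)) (length-map _ (strings m)) ⟩
  length (strings m) + length (strings m)
    ≡⟨ cong (λ n → n + n) (length-strings m) ⟩
  2 ^ m + 2 ^ m
    ≡⟨ cong (2 ^ m +_) (+-identityʳ (2 ^ m)) ⟨
  2 ^ suc m
    ∎
  where open ≡-Reasoning

∈-strings⁻ : ∀ m {u} → u ∈ strings m → length u ≡ m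
∈-strings⁻ zero    (here refl) = refl
∈-strings⁻ (suc m) u∈ with ∈-++⁻ (map (false ∷_) (strings m)) u∈
... | inj₁ p with _ , v∈ , refl ← ∈-map⁻ (false ∷_) p = cong suc (∈-strings⁻ m v∈)
... | inj₂ p with _ , v∈ , refl ← ∈-map⁻ (true ∷_) p = cong suc (∈-strings⁻ m v∈)

∑-strings-suc : ∀ m f →
  ∑ (strings (suc m)) f ≡ ∑ (strings m) (f ∘ (false ∷_)) + ∑ (strings m) (f ∘ (true ∷_))
∑-strings-suc m f = trans (∑-++ f (map (false ∷_) (strings m)) (map (true ∷_) (strings m)))
  (cong₂ _+_ (∑-map f (false ∷_) (strings m)) (∑-map f (true ∷_) (strings m)))

∑-strings-+ : ∀ m n f →
  ∑ (strings (m + n)) f ≡ ∑ (strings m) (λ u → ∑ (strings n) (λ v → f (u ++ v)))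
∑-strings-+ zero    n f = sym (+-identityʳ _)
∑-strings-+ (suc m) n f = trans (∑-strings-suc (m + n) f)
  (trans (cong₂ _+_ (∑-strings-+ m n _) (∑-strings-+ m n _))
    (sym (∑-strings-suc m (λ u → ∑ (strings n) (λ v → f (u ++ v))))))

take-++-length : ∀ {A : Set} {m} (u v : List A) → length u ≡ m → take m (u ++ v) ≡ u
take-++-length []      v refl = refl
take-++-length (x ∷ u) v refl = cong (x ∷_) (take-++-length u v refl)

drop-++-length : ∀ {A : Set} {m} (u v : List A) → length u ≡ m → drop m (u ++ v) ≡ v
drop-++-length []      v refl = refl
drop-++-length (x ∷ u) v refl = drop-++-length u v refl

-- gap L s = (s - L)(s - L - 1) / 2, a natural number vanishing at s = L and s = L + 1.
gap : ℕ → ℕ → ℕ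
gap zero    zero    = 0
gap zero    (suc s) = gap zero s + s
gap (suc L) zero    = gap L zero + suc L
gap (suc L) (suc s) = gap L s

-- The discrete derivative of the quadratic is `s - L`, written here without subtraction. Its part
-- `s` will cancel the exponent in `∑-fits`.
gap-suc : ∀ L s → gap L (suc s) + L ≡ gap L s + s
gap-suc zero    s       = +-identityʳ _
gap-suc (suc L) zero    = sym (+-identityʳ _)
gap-suc (suc L) (suc s) = trans (+-suc _ L) (trans (cong suc (gap-suc L s)) (sym (+-suc _ s)))

sum-tabulate-update : ∀ {k p q} (f g : Fin k → ℕ) a → f a + p ≡ g a + q →
  (∀ b → b ≢ a → f b ≡ g b) → sum (tabulate f) + p ≡ sum (tabulate g) + q
sum-tabulate-update {p = p} {q} f g zero eq eqs =
  trans (shuffle (f zero) _ p) (trans (cong₂ _+_ eq (cong sum (tabulate-cong λ b → eqs (suc b) λ ())))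
    (sym (shuffle (g zero) _ q)))
  where
  shuffle : ∀ x y z → x + y + z ≡ x + z + y
  shuffle = solve-∀
sum-tabulate-update {p = p} {q} f g (suc a) eq eqs =
  trans (+-assoc (f zero) _ p) (trans (cong₂ _+_ (eqs zero λ ())
    (sum-tabulate-update (f ∘ suc) (g ∘ suc) a eq λ b b≢a → eqs (suc b) λ { refl → b≢a refl }))
    (sym (+-assoc (g zero) _ q)))

-- The potential and the average cost

module _ {k : ℕ} where

  same : Fin k → Fin k → ℕ
  same a b = if does (a Fin.≟ b) then 1 else 0

  same-refl : ∀ a → same a a ≡ 1
  same-refl a with a Fin.≟ a
  ... | yes _  = refl
  ... | no a≢a = ⊥-elim (a≢a refl)

  same-≢ : ∀ {a b} → a ≢ b → same a b ≡ 0
  same-≢ {a} {b} a≢b with a Fin.≟ b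
  ... | yes a≡b = ⊥-elim (a≢b a≡b)
  ... | no _    = refl

  count : Fin k → List (Fin k) → ℕ
  count a xs = ∑ xs (same a)

  count-∷ʳ : ∀ b xs a → count b (xs ∷ʳ a) ≡ count b xs + same b a
  count-∷ʳ b xs a = trans (∑-++ (same b) xs (a ∷ [])) (cong (count b xs +_) (+-identityʳ (same b a)))

  fits : Fin k → List (Fin k) → Str → ℕ
  fits a xs u = if clash a xs u then 0 else 1

  -- The a-coloured vertices must be non-neighbours of the next one, the other
  -- adjacencies are free.
  ∑-fits : ∀ a xs → ∑ (strings (length xs)) (fits a xs) * 2 ^ count a xs ≡ 2 ^ length xs
  ∑-fits a []       = refl
  ∑-fits a (x ∷ xs) = trans (cong (_* 2 ^ count a (x ∷ xs)) (∑-strings-suc (length xs) (fits a (x ∷ xs)))) extend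
    where
    X = ∑ (strings (length xs)) (fits a xs)
    extend : (X + ∑ (strings (length xs)) (fits a (x ∷ xs) ∘ (true ∷_))) * 2 ^ count a (x ∷ xs) ≡ 2 ^ length (x ∷ xs)
    extend with does (a Fin.≟ x)
    ... | true  = trans (cong (λ z → (X + z) * (2 * 2 ^ count a xs))
                    (trans (∑-const 0 (strings (length xs))) (*-zeroʳ (length (strings (length xs))))))
                    (trans (lemma X (2 ^ count a xs)) (cong (2 *_) (∑-fits a xs)))
      where
      lemma : ∀ x p → (x + 0) * (2 * p) ≡ 2 * (x * p)
      lemma = solve-∀
    ... | false = trans (lemma X (2 ^ count a xs)) (cong (2 *_) (∑-fits a xs))
      where
      lemma : ∀ x p → (x + x) * p ≡ 2 * (x * p)
      lemma = solve-∀

  energy : ℕ → List (Fin k) → ℕ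
  energy L xs = sum (tabulate (λ b → gap L (count b xs)))

  energy-∷ʳ : ∀ L xs a → energy L (xs ∷ʳ a) + L ≡ energy L xs + count a xs
  energy-∷ʳ L xs a = sum-tabulate-update _ _ a
    (trans (cong (λ s → gap L s + L)
      (trans (count-∷ʳ a xs a) (trans (cong (count a xs +_) (same-refl a)) (+-comm _ 1))))
      (gap-suc L (count a xs)))
    λ b b≢a → cong (gap L) (trans (count-∷ʳ b xs a) (trans (cong (count b xs +_) (same-≢ b≢a)) (+-identityʳ _)))

module _ (k : ℕ) where
  open Machine k

  private
    -- `2 ^ L` is `4 * 2 ^ k`, hence at least `4 * k`. Half of `D`, times `suc j`, is at least the
    -- node cost `1 + k * (4 * j + 7)`.
    L D : ℕ
    L = 2 + k
    D = 2 * (7 * k + 1)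

    Q : List (Fin k) → ℕ
    Q xs = 2 ^ energy L xs

  Q-∷ʳ : ∀ xs a → Q (xs ∷ʳ a) * 2 ^ L ≡ Q xs * 2 ^ count a xs
  Q-∷ʳ xs a = begin
    Q (xs ∷ʳ a) * 2 ^ L               ≡⟨ ^-distribˡ-+-* 2 (energy L (xs ∷ʳ a)) L ⟨
    2 ^ (energy L (xs ∷ʳ a) + L)      ≡⟨ cong (2 ^_) (energy-∷ʳ L xs a) ⟩
    2 ^ (energy L xs + count a xs)    ≡⟨ ^-distribˡ-+-* 2 (energy L xs) (count a xs) ⟩
    Q xs * 2 ^ count a xs             ∎
    where open ≡-Reasoning

  -- The class size drops out: adding `a` multiplies `Q` by `2 ^ (count a xs - L)`, while only one
  -- column in `2 ^ count a xs` admits `a`.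
  ∑-fits-Q : ∀ xs a → 2 ^ L * (∑ (strings (length xs)) (fits a xs) * Q (xs ∷ʳ a)) ≡ 2 ^ length xs * Q xs
  ∑-fits-Q xs a = begin
    2 ^ L * (X * Q (xs ∷ʳ a))       ≡⟨ shuffle (2 ^ L) X (Q (xs ∷ʳ a)) ⟩
    X * (Q (xs ∷ʳ a) * 2 ^ L)       ≡⟨ cong (X *_) (Q-∷ʳ xs a) ⟩
    X * (Q xs * 2 ^ count a xs)     ≡⟨ shuffle′ X (Q xs) (2 ^ count a xs) ⟩
    X * 2 ^ count a xs * Q xs       ≡⟨ cong (_* Q xs) (∑-fits a xs) ⟩
    2 ^ length xs * Q xs            ∎
    where
    open ≡-Reasoning
    X = ∑ (strings (length xs)) (fits a xs)
    shuffle : ∀ l x q → l * (x * q) ≡ x * (q * l)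
    shuffle = solve-∀
    shuffle′ : ∀ x q c → x * (q * c) ≡ x * c * q
    shuffle′ = solve-∀

  bound : ℕ → ℕ → ℕ
  bound j q = D * suc j * q

  -- Half of the bound pays for the node and half for the children: a quarter of `bound (suc j) q`
  -- is at most half of `bound j q`, as `j + 2 ≤ 2 * (j + 1)`.
  bound-step : ∀ j m q s → 1 ≤ q → 4 * s ≤ m * bound (suc j) q →
    m * (1 + k * (4 * j + 7)) + s ≤ m * bound j q
  bound-step j m q s 1≤q 4s≤ = *-cancelˡ-≤ 4 (begin
    4 * (m * (1 + k * (4 * j + 7)) + s)              ≡⟨ e₁ m (1 + k * (4 * j + 7)) s ⟩
    m * (4 * (1 + k * (4 * j + 7))) + 4 * s          ≤⟨ +-monoʳ-≤ (m * (4 * (1 + k * (4 * j + 7)))) 4s≤ ⟩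
    m * (4 * (1 + k * (4 * j + 7))) + m * bound (suc j) q
                                                     ≡⟨ *-distribˡ-+ m (4 * (1 + k * (4 * j + 7))) (bound (suc j) q) ⟨
    m * (4 * (1 + k * (4 * j + 7)) + bound (suc j) q)
                                                     ≤⟨ *-monoʳ-≤ m (+-mono-≤ node children) ⟩
    m * (2 * bound j q + 2 * bound j q)              ≡⟨ e₂ m (bound j q) ⟩
    4 * (m * bound j q)                              ∎)
    where
    open ≤-Reasoning
    e₁ : ∀ m x s → 4 * (m * x + s) ≡ m * (4 * x) + 4 * s
    e₁ = solve-∀
    e₂ : ∀ m b → m * (2 * b + 2 * b) ≡ 4 * (m * b)
    e₂ = solve-∀
    node : 4 * (1 + k * (4 * j + 7)) ≤ 2 * bound j q
    node = begin
      4 * (1 + k * (4 * j + 7))                             ≤⟨ m≤m+n _ (4 * (3 * k * j + j)) ⟩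
      4 * (1 + k * (4 * j + 7)) + 4 * (3 * k * j + j)       ≡⟨ e₃ k j ⟩
      2 * (D * suc j) * 1                                   ≤⟨ *-monoʳ-≤ (2 * (D * suc j)) 1≤q ⟩
      2 * (D * suc j) * q                                   ≡⟨ *-assoc 2 (D * suc j) q ⟩
      2 * bound j q                                         ∎
      where
      e₃ : ∀ k j → 4 * (1 + k * (4 * j + 7)) + 4 * (3 * k * j + j) ≡ 2 * (2 * (7 * k + 1) * suc j) * 1
      e₃ = solve-∀
    children : bound (suc j) q ≤ 2 * bound j q
    children = begin
      D * suc (suc j) * q                   ≤⟨ m≤m+n _ (D * j * q) ⟩
      D * suc (suc j) * q + D * j * q       ≡⟨ e₄ D j q ⟩
      2 * bound j q                         ∎
      where
      e₄ : ∀ d j q → d * suc (suc j) * q + d * j * q ≡ 2 * (d * suc j * q)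
      e₄ = solve-∀

  ∑-branches : ∀ xs w (sub : Fin k → ℕ) → (∀ a → sub a ≤ 2 ^ w * bound (suc (length xs)) (Q (xs ∷ʳ a))) →
    4 * ∑ colours (λ a → ∑ (strings (length xs)) (fits a xs) * sub a) ≤
    2 ^ length xs * 2 ^ w * bound (suc (length xs)) (Q xs)
  -- Multiplying by `2 ^ k` completes the factor 4 to `2 ^ L`; it is regained at the end from
  -- `k ≤ 2 ^ k`.
  ∑-branches xs w sub sub≤ = *-cancelˡ-≤ (2 ^ k) {{m^n≢0 2 k}} (begin
    2 ^ k * (4 * ∑ colours F)                 ≡⟨ e₁ (2 ^ k) (∑ colours F) ⟩
    2 ^ L * ∑ colours F                       ≡⟨ ∑-*ˡ (2 ^ L) F colours ⟨
    ∑ colours (λ a → 2 ^ L * F a)             ≤⟨ ∑-mono colours (λ {a} _ → each a) ⟩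
    ∑ colours (λ _ → R)                       ≡⟨ ∑-const R colours ⟩
    length colours * R                        ≡⟨ cong (_* R) (proj₁ (proj₂ (proj₂ (allColours k)))) ⟩
    k * R                                     ≤⟨ *-monoˡ-≤ R (<⇒≤ (n<2^n k)) ⟩
    2 ^ k * R                                 ∎)
    where
    open ≤-Reasoning
    j = length xs
    R = 2 ^ j * 2 ^ w * bound (suc j) (Q xs)
    F : Fin k → ℕ
    F a = ∑ (strings j) (fits a xs) * sub a
    n<2^n : ∀ n → n < 2 ^ n
    n<2^n zero    = s≤s z≤n
    n<2^n (suc n) = ≤-trans (+-mono-≤ (≤-trans (s≤s z≤n) (n<2^n n)) (n<2^n n))
      (≤-reflexive (cong (2 ^ n +_) (sym (+-identityʳ (2 ^ n)))))
    e₁ : ∀ p s → p * (4 * s) ≡ 2 * (2 * p) * s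
    e₁ = solve-∀
    each : ∀ a → 2 ^ L * F a ≤ R
    each a = begin
      2 ^ L * (X * sub a)
        ≤⟨ *-monoʳ-≤ (2 ^ L) (*-monoʳ-≤ X (sub≤ a)) ⟩
      2 ^ L * (X * (2 ^ w * (D * suc (suc j) * Q (xs ∷ʳ a))))
        ≡⟨ e₂ (2 ^ L) X (2 ^ w) (D * suc (suc j)) (Q (xs ∷ʳ a)) ⟩
      2 ^ L * (X * Q (xs ∷ʳ a)) * (2 ^ w * (D * suc (suc j)))
        ≡⟨ cong (_* (2 ^ w * (D * suc (suc j)))) (∑-fits-Q xs a) ⟩
      2 ^ j * Q xs * (2 ^ w * (D * suc (suc j)))
        ≡⟨ e₃ (2 ^ j) (Q xs) (2 ^ w) (D * suc (suc j)) ⟩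
      R ∎
      where
      X = ∑ (strings j) (fits a xs)
      e₂ : ∀ l x w d q → l * (x * (w * (d * q))) ≡ l * (x * q) * (w * d)
      e₂ = solve-∀
      e₃ : ∀ j q w d → j * q * (w * d) ≡ j * w * (d * q)
      e₃ = solve-∀

  -- The next column decides which colours survive, and the later columns alone decide the cost
  -- below them; so for each colour the sum over all strings factors.
  ∑-cost : ∀ r xs → ∑ (strings (width (length xs) r)) (cost r xs) ≤
                     2 ^ width (length xs) r * bound (length xs) (Q xs)
  ∑-cost zero    xs = +-mono-≤ (*-mono-≤ (*-mono-≤ 1≤D (s≤s (z≤n {length xs}))) (m^n>0 2 (energy L xs))) z≤n
    where
    1≤D : 1 ≤ D
    1≤D = ≤-trans (m≤n+m 1 (7 * k)) (m≤m+n _ _)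
  ∑-cost (suc r) xs = begin
    ∑ (strings (j + w)) (cost (suc r) xs)
      ≡⟨ ∑-strings-+ j w (cost (suc r) xs) ⟩
    ∑ (strings j) (λ u → ∑ (strings w) (λ v → cost (suc r) xs (u ++ v)))
      ≡⟨ ∑-cong (strings j) (λ {u} u∈ → ∑-cong (strings w) (λ {v} _ → split-cost u v (∈-strings⁻ j u∈))) ⟩
    ∑ (strings j) (λ u → ∑ (strings w) (λ v → E + ∑ colours (λ a → fits a xs u * c a v)))
      ≡⟨ ∑-cong (strings j) (λ {u} _ → inner u) ⟩
    ∑ (strings j) (λ u → 2 ^ w * E + ∑ colours (λ a → fits a xs u * sub a))
      ≡⟨ ∑-+ (λ _ → 2 ^ w * E) (λ u → ∑ colours (λ a → fits a xs u * sub a)) (strings j) ⟩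
    ∑ (strings j) (λ _ → 2 ^ w * E) + ∑ (strings j) (λ u → ∑ colours (λ a → fits a xs u * sub a))
      ≡⟨ cong₂ _+_ (trans (∑-const (2 ^ w * E) (strings j)) (cong (_* (2 ^ w * E)) (length-strings j)))
           (trans (∑-swap (λ u a → fits a xs u * sub a) (strings j) colours)
             (∑-cong colours (λ {a} _ → ∑-*ʳ (sub a) (fits a xs) (strings j)))) ⟩
    2 ^ j * (2 ^ w * E) + S
      ≡⟨ cong (_+ S) (*-assoc (2 ^ j) (2 ^ w) E) ⟨
    2 ^ j * 2 ^ w * E + S
      ≤⟨ bound-step j (2 ^ j * 2 ^ w) (Q xs) S (m^n>0 2 (energy L xs)) (∑-branches xs w sub sub≤) ⟩
    2 ^ j * 2 ^ w * bound j (Q xs)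
      ≡⟨ cong (_* bound j (Q xs)) (^-distribˡ-+-* 2 j w) ⟨
    2 ^ (j + w) * bound j (Q xs)
      ∎
    where
    open ≤-Reasoning
    j = length xs
    w = width (suc j) r
    E = 1 + k * (4 * j + 7)
    c : Fin k → Str → ℕ
    c a = cost r (xs ∷ʳ a)
    sub : Fin k → ℕ
    sub a = ∑ (strings w) (c a)
    S = ∑ colours (λ a → ∑ (strings j) (fits a xs) * sub a)
    sub≤ : ∀ a → sub a ≤ 2 ^ w * bound (suc j) (Q (xs ∷ʳ a))
    sub≤ a = subst (λ m → ∑ (strings (width m r)) (c a) ≤ 2 ^ width m r * bound m (Q (xs ∷ʳ a)))
      (length-∷ʳ a xs) (∑-cost r (xs ∷ʳ a))
    branch : ∀ f n → (if f then 0 else n) ≡ (if f then 0 else 1) * n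
    branch true  n = refl
    branch false n = sym (+-identityʳ n)
    split-cost : ∀ u v → length u ≡ j → cost (suc r) xs (u ++ v) ≡ E + ∑ colours (λ a → fits a xs u * c a v)
    split-cost u v len rewrite take-++-length u v len | drop-++-length u v len = cong suc
      (trans (∑-+ (λ _ → 4 * j + 7) (λ a → if clash a xs u then 0 else c a v) colours)
        (cong₂ _+_ (trans (∑-const (4 * j + 7) colours)
                     (cong (_* (4 * j + 7)) (proj₁ (proj₂ (proj₂ (allColours k))))))
          (∑-cong colours (λ {a} _ → branch (clash a xs u) (c a v)))))
    inner : ∀ u → ∑ (strings w) (λ v → E + ∑ colours (λ a → fits a xs u * c a v)) ≡
                  2 ^ w * E + ∑ colours (λ a → fits a xs u * sub a)
    inner u = trans (∑-+ (λ _ → E) (λ v → ∑ colours (λ a → fits a xs u * c a v)) (strings w))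
      (cong₂ _+_ (trans (∑-const E (strings w)) (cong (_* E) (length-strings w)))
        (trans (∑-swap (λ v a → fits a xs u * c a v) (strings w) colours)
          (∑-cong colours (λ {a} _ → ∑-*ˡ (fits a xs u) (c a) (strings w)))))

-- Graphs and their encodings

-- `width` unrolls from the first column, Pascal's rule for `n C 2` from the last.
width-∷ʳ : ∀ j r → width j (suc r) ≡ width j r + (j + r)
width-∷ʳ j zero    = refl
width-∷ʳ j (suc r) = begin
  j + width (suc j) (suc r)            ≡⟨ cong (j +_) (width-∷ʳ (suc j) r) ⟩
  j + (width (suc j) r + (suc j + r))  ≡⟨ +-assoc j _ _ ⟨
  width j (suc r) + (suc j + r)        ≡⟨ cong (width j (suc r) +_) (+-suc j r) ⟨
  width j (suc r) + (j + suc r)        ∎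
  where open ≡-Reasoning

width-C2 : ∀ n → width 0 n ≡ n C 2
width-C2 zero    = refl
width-C2 (suc n) = begin
  width 0 (suc n)       ≡⟨ width-∷ʳ 0 n ⟩
  width 0 n + n         ≡⟨ cong₂ _+_ (width-C2 n) (sym (nC1≡n n)) ⟩
  n C 2 + n C 1         ≡⟨ +-comm (n C 2) (n C 1) ⟩
  n C 1 + n C 2         ≡⟨ nCk+nC[k+1]≡[n+1]C[k+1] n 1 ⟩
  suc n C 2             ∎
  where open ≡-Reasoning

-- Every column but that of the first vertex has at least one bit, so `suc (length y)` columns are
-- enough for any string `y`.
≤-width : ∀ j r → r ≤ width (suc j) r
≤-width j zero    = z≤n
≤-width j (suc r) = s≤s (≤-trans (≤-width (suc j) r) (m≤n+m _ j))

-- e d i says whether the vertices i and j + d are adjacent.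
columns : (ℕ → ℕ → Bool) → ℕ → ℕ → Str
columns e j zero    = []
columns e j (suc r) = applyUpTo (e 0) j ++ columns (e ∘ suc) (suc j) r

length-columns : ∀ e j r → length (columns e j r) ≡ width j r
length-columns e j zero    = refl
length-columns e j (suc r) = trans (length-++ (applyUpTo (e 0) j))
  (cong₂ _+_ (length-applyUpTo (e 0) j) (length-columns (e ∘ suc) (suc j) r))

entry : A → List A → ℕ → A
entry d []       _       = d
entry d (x ∷ xs) zero    = x
entry d (x ∷ xs) (suc i) = entry d xs i

applyUpTo-entry : ∀ (d : A) xs → applyUpTo (entry d xs) (length xs) ≡ xs
applyUpTo-entry d []       = refl
applyUpTo-entry d (x ∷ xs) = cong (x ∷_) (applyUpTo-entry d xs)

infixr 5 _◂_
_◂_ : A → (ℕ → A) → ℕ → A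
(x ◂ f) zero    = x
(x ◂ f) (suc i) = f i

-- Proper colourings and the relation `Ext`

module _ {k : ℕ} where

  clash-applyUpTo⁺ : ∀ {a : Fin k} (c : ℕ → Fin k) e j →
    (∀ i → i < j → e i ≡ true → c i ≢ a) → clash a (applyUpTo c j) (applyUpTo e j) ≡ false
  clash-applyUpTo⁺ c e zero    ok = refl
  clash-applyUpTo⁺ {a} c e (suc j) ok
    rewrite clash-applyUpTo⁺ {a} (c ∘ suc) (e ∘ suc) j (λ i i<j → ok (suc i) (s≤s i<j))
    with e 0 in e0 | a Fin.≟ c 0
  ... | false | _       = refl
  ... | true  | no _    = refl
  ... | true  | yes eq  = ⊥-elim (ok 0 (s≤s z≤n) e0 (sym eq))

  clash-applyUpTo⁻ : ∀ {a : Fin k} (c : ℕ → Fin k) e j →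
    clash a (applyUpTo c j) (applyUpTo e j) ≡ false → ∀ i → i < j → e i ≡ true → c i ≢ a
  clash-applyUpTo⁻ {a} c e (suc j) ok with e 0 in e0 | a Fin.≟ c 0
  ... | false | _     = λ { zero _ ei → case (trans (sym e0) ei)
                          ; (suc i) (s≤s i<j) → clash-applyUpTo⁻ (c ∘ suc) (e ∘ suc) j ok i i<j }
    where
    case : ∀ {X : Set} → false ≡ true → X
    case ()
  ... | true | no a≢ = λ { zero _ _ eq → a≢ (sym eq)
                         ; (suc i) (s≤s i<j) → clash-applyUpTo⁻ (c ∘ suc) (e ∘ suc) j ok i i<j }

  -- Vertices are natural numbers and columns are counted from `j`, so that passing to the next
  -- vertex is `e ∘ suc`, with no change of index type.
  Good : (ℕ → ℕ → Bool) → (ℕ → Fin k) → ℕ → ℕ → Set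
  Good e c j r = ∀ d i → d < r → i < j + d → e d i ≡ true → c i ≢ c (j + d)

  good⇒ext : ∀ e c j r → 0 < j + r → Good e c j r → Ext (applyUpTo c j) (columns e j r)
  good⇒ext e c (suc j) zero    _ good = done
  good⇒ext e c j       (suc r) _ good =
    more (subst₂ _≤_ (sym len) (sym (length-columns e j (suc r))) (m≤m+n j _)) (c j)
      (subst (λ u → clash (c j) (applyUpTo c j) u ≡ false)
        (sym (take-++-length (applyUpTo (e 0) j) _ len′))
        (clash-applyUpTo⁺ c (e 0) j λ i i<j →
          subst (λ m → e 0 i ≡ true → c i ≢ c m) (+-identityʳ j)
            (good 0 i (s≤s z≤n) (subst (i <_) (sym (+-identityʳ j)) i<j))))
      (subst₂ Ext (sym (applyUpTo-∷ʳ c j)) (sym (drop-++-length (applyUpTo (e 0) j) _ len′))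
        (good⇒ext (e ∘ suc) c (suc j) r (s≤s z≤n) λ d i d<r i< →
          subst (λ m → e (suc d) i ≡ true → c i ≢ c m) (+-suc j d)
            (good (suc d) i (s≤s d<r) (subst (i <_) (sym (+-suc j d)) i<))))
    where
    len : length (applyUpTo c j) ≡ j
    len = length-applyUpTo c j
    len′ : length (applyUpTo (e 0) j) ≡ length (applyUpTo c j)
    len′ = trans (length-applyUpTo (e 0) j) (sym len)

  ext⇒good : ∀ {xs vs} → Ext xs vs → ∃ λ e → ∃ λ c → ∃ λ r → 0 < length xs + r ×
    vs ≡ columns e (length xs) r × applyUpTo c (length xs) ≡ xs × Good e c (length xs) r
  -- The colouring has to be total on the natural numbers; `done` requires a first colour `x`, which
  -- supplies the default.
  ext⇒good (done {x} {xs}) = (λ _ _ → false) , entry x (x ∷ xs) , 0 , s≤s z≤n , refl ,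
    applyUpTo-entry x (x ∷ xs) , λ _ _ ()
  ext⇒good {xs} {vs} (more len a ok ext) with ext⇒good ext
  ... | e , c , r , _ , cols , colouring , good rewrite length-∷ʳ a xs =
    entry false (take j vs) ◂ e , c , suc r , subst (0 <_) (sym (+-suc j r)) (s≤s z≤n) ,
    trans (sym (take++drop≡id j vs)) (cong₂ _++_ col cols) , old , good′
    where
    j = length xs
    col : take j vs ≡ applyUpTo (entry false (take j vs)) j
    col = trans (sym (applyUpTo-entry false (take j vs)))
      (cong (applyUpTo (entry false (take j vs))) (trans (length-take j vs) (m≤n⇒m⊓n≡m len)))
    split : applyUpTo c j ≡ xs × c j ≡ a
    split = ∷ʳ-injective (applyUpTo c j) xs (trans (applyUpTo-∷ʳ c j) colouring)
    old = proj₁ split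
    good′ : Good (entry false (take j vs) ◂ e) c j (suc r)
    good′ zero    i _         i< rewrite +-identityʳ j | proj₂ split =
      clash-applyUpTo⁻ c _ j (subst₂ (λ ys u → clash a ys u ≡ false) (sym old) col ok) i i<
    good′ (suc d) i (s≤s d<r) i< rewrite +-suc j d = good d i d<r i<

extend : ∀ {n} → A → (Fin n → A) → ℕ → A
extend {n = zero}  d f _       = d
extend {n = suc n} d f zero    = f zero
extend {n = suc n} d f (suc i) = extend d (f ∘ suc) i

extend-toℕ : ∀ {n} (d : A) (f : Fin n → A) i → extend d f (toℕ i) ≡ f i
extend-toℕ d f zero    = refl
extend-toℕ d f (suc i) = extend-toℕ d (f ∘ suc) i

tabulate≡applyUpTo : ∀ {n} (f : Fin n → A) g → (∀ i → f i ≡ g (toℕ i)) → tabulate f ≡ applyUpTo g n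
tabulate≡applyUpTo {n = zero}  f g eq = refl
tabulate≡applyUpTo {n = suc n} f g eq = cong₂ _∷_ (eq zero) (tabulate≡applyUpTo (f ∘ suc) (g ∘ suc) (eq ∘ suc))

concat-tabulate : ∀ {n} (h : Fin n → Str) e j →
  (∀ d → h d ≡ applyUpTo (e (toℕ d)) (j + toℕ d)) → concat (tabulate h) ≡ columns e j n
concat-tabulate {zero}  h e j eq = refl
concat-tabulate {suc n} h e j eq = cong₂ _++_
  (trans (eq zero) (cong (applyUpTo (e 0)) (+-identityʳ j)))
  (concat-tabulate (h ∘ suc) (e ∘ suc) (suc j) λ d →
    trans (eq (suc d)) (cong (applyUpTo (e (suc (toℕ d)))) (+-suc j (toℕ d))))

module _ {n : ℕ} (G : Graph n) where
  open Graph G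

  -- Agreement for `i < j` is enough, so this applies both to the adjacencies of a given graph and
  -- to the arbitrary array from which `graph` is built.
  encode-columns : ∀ e → (∀ i j → toℕ i < toℕ j → adj i j ≡ e (toℕ j) (toℕ i)) → encode G ≡ columns e 0 n
  encode-columns e eq = begin
    map edge (concatMap column (allFin n))        ≡⟨ map-concatMap edge column (allFin n) ⟩
    concat (map (map edge ∘ column) (allFin n))   ≡⟨ cong concat (map-tabulate id (map edge ∘ column)) ⟩
    concat (tabulate (map edge ∘ column))         ≡⟨ concat-tabulate (map edge ∘ column) e 0 bits ⟩
    columns e 0 n                                 ∎
    where
    open ≡-Reasoning
    edge : Fin n × Fin n → Bool
    edge (i , j) = adj i j
    column : Fin n → List (Fin n × Fin n)
    column j = map (λ i → Fin.inject i , j) (allFin (toℕ j))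
    bits : ∀ j → map edge (column j) ≡ applyUpTo (e (toℕ j)) (toℕ j)
    bits j = begin
      map edge (column j)
        ≡⟨ map-∘ (allFin (toℕ j)) ⟨
      map (λ i → adj (Fin.inject i) j) (allFin (toℕ j))
        ≡⟨ map-tabulate id (λ i → adj (Fin.inject i) j) ⟩
      tabulate (λ i → adj (Fin.inject i) j)
        ≡⟨ tabulate≡applyUpTo _ _ (λ i → trans
             (eq (Fin.inject i) j (subst (_< toℕ j) (sym (toℕ-inject i)) (toℕ<n i)))
             (cong (e (toℕ j)) (toℕ-inject i))) ⟩
      applyUpTo (e (toℕ j)) (toℕ j) ∎

  adjacency : ℕ → ℕ → Bool
  adjacency = extend (λ _ → false) (λ j → extend false (λ i → adj i j))

  adjacency-toℕ : ∀ i j → adj i j ≡ adjacency (toℕ j) (toℕ i)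
  adjacency-toℕ i j = sym (trans
    (cong (λ f → f (toℕ i)) (extend-toℕ (λ _ → false) (λ j → extend false (λ i → adj i j)) j))
    (extend-toℕ false (λ i → adj i j) i))

  encode≡columns : encode G ≡ columns adjacency 0 n
  encode≡columns = encode-columns adjacency λ i j _ → adjacency-toℕ i j

  length-encode : length (encode G) ≡ n C 2
  length-encode = trans (cong length encode≡columns) (trans (length-columns adjacency 0 n) (width-C2 n))

module _ {k : ℕ} where

  colorable⇒ext : ∀ {n} (G : Graph (suc n)) → Colorable k G → Ext {k} [] (encode G)
  colorable⇒ext {n} G (c , proper) = subst (Ext []) (sym (encode≡columns G))
    (good⇒ext (adjacency G) colour 0 (suc n) (s≤s z≤n) good)
    where
    colour : ℕ → Fin k
    colour = extend (c zero) c
    good : Good (adjacency G) colour 0 (suc n)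
    good d i d<n i<d eq same
      with i′ , refl ← (∃ λ j → toℕ j ≡ i) ∋ (fromℕ< (<-trans i<d d<n) , toℕ-fromℕ< _)
         | d′ , refl ← (∃ λ j → toℕ j ≡ d) ∋ (fromℕ< d<n , toℕ-fromℕ< _) =
      proper i′ d′ (Equivalence.from T-≡ (trans (adjacency-toℕ G i′ d′) eq))
        (trans (sym (extend-toℕ _ c i′)) (trans same (extend-toℕ _ c d′)))

module _ (e : ℕ → ℕ → Bool) where

  private
    -- `e` is arbitrary on and beyond the diagonal; keeping only `i < j` before symmetrising removes
    -- loops and conflicting values.
    upper : ℕ → ℕ → Bool
    upper i j = (i <ᵇ j) ∧ e j i

    <ᵇ-true : ∀ {i j} → i < j → (i <ᵇ j) ≡ true
    <ᵇ-true i<j = Equivalence.to T-≡ (<⇒<ᵇ i<j)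

    <ᵇ-false : ∀ {i j} → j ≤ i → (i <ᵇ j) ≡ false
    <ᵇ-false {i} {j} j≤i with i <ᵇ j in eq
    ... | false = refl
    ... | true  = ⊥-elim (<⇒≱ (<ᵇ⇒< i j (Equivalence.from T-≡ eq)) j≤i)

  graph : ∀ n → Graph n
  graph n = record
    { adj       = λ i j → upper (toℕ i) (toℕ j) ∨ upper (toℕ j) (toℕ i)
    ; symmetric = λ i j → ∨-comm (upper (toℕ i) (toℕ j)) (upper (toℕ j) (toℕ i))
    ; loopless  = λ i → cong (λ b → (b ∧ e (toℕ i) (toℕ i)) ∨ (b ∧ e (toℕ i) (toℕ i))) (<ᵇ-false (≤-refl {toℕ i}))
    }

  graph-adj : ∀ {n} (i j : Fin n) → toℕ i < toℕ j → Graph.adj (graph n) i j ≡ e (toℕ j) (toℕ i)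
  graph-adj i j i<j rewrite <ᵇ-true i<j | <ᵇ-false (<⇒≤ i<j) = ∨-identityʳ _

  encode-graph : ∀ n → encode (graph n) ≡ columns e 0 n
  encode-graph n = encode-columns (graph n) e graph-adj

  good⇒colorable : ∀ {k n} (c : ℕ → Fin k) → Good e c 0 n → Colorable k (graph n)
  good⇒colorable {n = n} c good = c ∘ toℕ , proper
    where
    ordered : ∀ i j → toℕ i < toℕ j → T (Graph.adj (graph n) i j) → c (toℕ i) ≢ c (toℕ j)
    ordered i j i<j edge = good (toℕ j) (toℕ i) (toℕ<n j) i<j
      (trans (sym (graph-adj i j i<j)) (Equivalence.to T-≡ edge))
    proper : ∀ i j → T (Graph.adj (graph n) i j) → c (toℕ i) ≢ c (toℕ j)
    proper i j edge with <-cmp (toℕ i) (toℕ j)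
    ... | tri< i<j _ _ = ordered i j i<j edge
    ... | tri> _ _ j<i = ordered j i j<i (subst T (Graph.symmetric (graph n) i j) edge) ∘ sym
    ... | tri≈ _ i≡j _ with refl ← toℕ-injective i≡j = ⊥-elim (subst T (Graph.loopless (graph n) i) edge)

kColoring⇔ext : ∀ k y → kColoring k y ⇔ Ext {k} [] y
kColoring⇔ext k y = mk⇔ to from
  where
  to : kColoring k y → Ext {k} [] y
  to (suc n , _ , G , refl , colorable) = colorable⇒ext G colorable
  from : Ext {k} [] y → kColoring k y
  from ext with e , c , suc r , _ , refl , _ , good ← ext⇒good ext =
    suc r , _ , graph e (suc r) , encode-graph e (suc r) , good⇒colorable e c good

-- Real numbers

infixl 6 _⊕_ _⊖_
infixl 7 _⊛_

_⊕_ _⊖_ _⊛_ : ℚ → ℚ → ℚ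
_⊕_ = ℚ._+_
_⊖_ = ℚ._-_
_⊛_ = ℚ._*_

0≤p*q : ∀ {p q} → 0ℚ ℚ.≤ p → 0ℚ ℚ.≤ q → 0ℚ ℚ.≤ p ⊛ q
0≤p*q {p} {q} 0≤p 0≤q = ℚ.nonNegative⁻¹ _
  {{ℚ.nonNeg*nonNeg⇒nonNeg p {{ℚ.nonNegative 0≤p}} q {{ℚ.nonNegative 0≤q}}}}

0≤p+q : ∀ {p q} → 0ℚ ℚ.≤ p → 0ℚ ℚ.≤ q → 0ℚ ℚ.≤ p ⊕ q
0≤p+q = ℚ.+-mono-≤

p≤q⇒0≤q-p : ∀ {p q} → p ℚ.≤ q → 0ℚ ℚ.≤ q ⊖ p
p≤q⇒0≤q-p {p} {q} p≤q = subst (ℚ._≤ q ⊖ p) (ℚ.+-inverseʳ p) (ℚ.+-monoˡ-≤ (ℚ.- p) p≤q)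

0≤q-p⇒p≤q : ∀ {p q} → 0ℚ ℚ.≤ q ⊖ p → p ℚ.≤ q
0≤q-p⇒p≤q {p} {q} h = subst₂ ℚ._≤_ (ℚ.+-identityˡ p) (solve 2 (λ p q → q :- p :+ p := q) refl p q)
  (ℚ.+-monoˡ-≤ p h)
  where open +-*-Solver

p≤p+q : ∀ {p q} → 0ℚ ℚ.≤ q → p ℚ.≤ p ⊕ q
p≤p+q {p} {q} 0≤q = subst (ℚ._≤ p ⊕ q) (ℚ.+-identityʳ p) (ℚ.+-monoʳ-≤ p 0≤q)

p≤∣p∣ : ∀ p → p ℚ.≤ ∣ p ∣
p≤∣p∣ p with ℚ.≤-total 0ℚ p
... | inj₁ 0≤p = ℚ.≤-reflexive (sym (ℚ.0≤p⇒∣p∣≡p 0≤p))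
... | inj₂ p≤0 = ℚ.≤-trans p≤0 (ℚ.0≤∣p∣ p)

-- For `p ≥ 0` the product is at least `- p * η`, and `p ≤ A`; for `p ≤ 0` it is at least `p * B`,
-- hence at least `- η * B`. The identities display this as sums of nonnegative products.
*-almost-nonNeg : ∀ {p q A B η} → 0ℚ ℚ.≤ η → ∣ p ∣ ℚ.≤ A → ∣ q ∣ ℚ.≤ B →
  0ℚ ℚ.≤ p ⊕ η → 0ℚ ℚ.≤ q ⊕ η → 0ℚ ℚ.≤ p ⊛ q ⊕ (A ⊛ η ⊕ B ⊛ η)
*-almost-nonNeg {p} {q} {A} {B} {η} 0≤η p≤A q≤B 0≤p+η 0≤q+η with ℚ.≤-total 0ℚ p
... | inj₁ 0≤p = subst (0ℚ ℚ.≤_) (identity p q A B η)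
  (0≤p+q (0≤p+q (0≤p*q 0≤p 0≤q+η) (0≤p*q (p≤q⇒0≤q-p (ℚ.≤-trans (p≤∣p∣ p) p≤A)) 0≤η))
         (0≤p*q (ℚ.≤-trans (ℚ.0≤∣p∣ q) q≤B) 0≤η))
  where
  open +-*-Solver
  identity : ∀ p q A B η → p ⊛ (q ⊕ η) ⊕ (A ⊖ p) ⊛ η ⊕ B ⊛ η ≡ p ⊛ q ⊕ (A ⊛ η ⊕ B ⊛ η)
  identity = solve 5 (λ p q A B η →
    p :* (q :+ η) :+ (A :- p) :* η :+ B :* η := p :* q :+ (A :* η :+ B :* η)) refl
... | inj₂ p≤0 = subst (0ℚ ℚ.≤_) (identity p q A B η)
  (0≤p+q (0≤p+q (0≤p*q (p≤q⇒0≤q-p p≤0) (p≤q⇒0≤q-p (ℚ.≤-trans (p≤∣p∣ q) q≤B)))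
                (0≤p*q 0≤p+η (ℚ.≤-trans (ℚ.0≤∣p∣ q) q≤B)))
         (0≤p*q (ℚ.≤-trans (ℚ.0≤∣p∣ p) p≤A) 0≤η))
  where
  open +-*-Solver
  identity : ∀ p q A B η → (0ℚ ⊖ p) ⊛ (B ⊖ q) ⊕ (p ⊕ η) ⊛ B ⊕ A ⊛ η ≡ p ⊛ q ⊕ (A ⊛ η ⊕ B ⊛ η)
  identity = solve 5 (λ p q A B η →
    (con 0ℚ :- p) :* (B :- q) :+ (p :+ η) :* B :+ A :* η := p :* q :+ (A :* η :+ B :* η)) refl

pointwise⇒≤ : ∀ {x y} → (∀ n → seq x n ℚ.≤ seq y n) → x R.≤ y
pointwise⇒≤ x≤y δ δ>0 = 0 , λ n _ → ℚ.≤-trans (x≤y n) (p≤p+q (ℚ.<⇒≤ δ>0))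

pointwise⇒≈ : ∀ {x y} → (∀ n → seq x n ≡ seq y n) → x R.≈ y
pointwise⇒≈ {x} {y} eq =
  pointwise⇒≤ {x} {y} (ℚ.≤-reflexive ∘ eq) , pointwise⇒≤ {y} {x} (ℚ.≤-reflexive ∘ sym ∘ eq)

infixr 4 _⟨≤⟩_
_⟨≤⟩_ : ∀ {x y z} → x R.≤ y → y R.≤ z → x R.≤ z
(_⟨≤⟩_ {x} {y} {z} x≤y y≤z) δ δ>0 with x≤y (½ ⊛ δ) (½-pos δ>0) | y≤z (½ ⊛ δ) (½-pos δ>0)
... | M , p | N , q = M ⊔ N , λ n h → begin
  seq x n                          ≤⟨ p n (m⊔n≤o⇒m≤o M N h) ⟩
  seq y n ⊕ ½ ⊛ δ                  ≤⟨ ℚ.+-monoˡ-≤ (½ ⊛ δ) (q n (m⊔n≤o⇒n≤o M N h)) ⟩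
  seq z n ⊕ ½ ⊛ δ ⊕ ½ ⊛ δ          ≡⟨ ℚ.+-assoc (seq z n) (½ ⊛ δ) (½ ⊛ δ) ⟩
  seq z n ⊕ (½ ⊛ δ ⊕ ½ ⊛ δ)        ≡⟨ cong (seq z n ⊕_) (½-split δ) ⟩
  seq z n ⊕ δ                      ∎
  where open ℚ.≤-Reasoning

+-mono-≤ᴿ : ∀ {x y z w} → x R.≤ y → z R.≤ w → x R.+ z R.≤ y R.+ w
+-mono-≤ᴿ {x} {y} {z} {w} x≤y z≤w δ δ>0 with x≤y (½ ⊛ δ) (½-pos δ>0) | z≤w (½ ⊛ δ) (½-pos δ>0)
... | M , p | N , q = M ⊔ N , λ n h → begin
  seq x n ⊕ seq z n                          ≤⟨ ℚ.+-mono-≤ (p n (m⊔n≤o⇒m≤o M N h)) (q n (m⊔n≤o⇒n≤o M N h)) ⟩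
  (seq y n ⊕ ½ ⊛ δ) ⊕ (seq w n ⊕ ½ ⊛ δ)      ≡⟨ interchange (seq y n) (seq w n) (½ ⊛ δ) ⟩
  seq y n ⊕ seq w n ⊕ (½ ⊛ δ ⊕ ½ ⊛ δ)        ≡⟨ cong (seq y n ⊕ seq w n ⊕_) (½-split δ) ⟩
  seq y n ⊕ seq w n ⊕ δ                      ∎
  where
  open ℚ.≤-Reasoning
  open +-*-Solver
  interchange : ∀ y w h → (y ⊕ h) ⊕ (w ⊕ h) ≡ y ⊕ w ⊕ (h ⊕ h)
  interchange = solve 3 (λ y w h → (y :+ h) :+ (w :+ h) := y :+ w :+ (h :+ h)) refl

x≤y⇒0≤y-x : ∀ {x y} → x R.≤ y → 0ℝ R.≤ y R.- x
x≤y⇒0≤y-x {x} {y} x≤y δ δ>0 with x≤y δ δ>0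
... | N , p = N , λ n h → subst (0ℚ ℚ.≤_) (identity (seq x n) (seq y n) δ) (p≤q⇒0≤q-p (p n h))
  where
  open +-*-Solver
  identity : ∀ x y d → y ⊕ d ⊖ x ≡ y ⊖ x ⊕ d
  identity = solve 3 (λ x y d → y :+ d :- x := y :- x :+ d) refl

-- A nonnegative real may have negative approximations, but eventually only slightly so; as the
-- sequences are bounded, their products stay above `- δ`.
*-nonNeg : ∀ {x y} → 0ℝ R.≤ x → 0ℝ R.≤ y → 0ℝ R.≤ x R.* y
*-nonNeg {x} {y} 0≤x 0≤y δ δ>0 =
  let A , A>0 , P , x≤A   = eventually-bounded (cauchy x)
      B , B>0 , Q , y≤B   = eventually-bounded (cauchy y)
      η , η>0 , Aη+Bη≡δ   = apportion A>0 B>0 δ>0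
      M , p               = 0≤x η η>0
      N , q               = 0≤y η η>0
  in (P ⊔ Q) ⊔ (M ⊔ N) , λ n h →
    let hPQ = m⊔n≤o⇒m≤o (P ⊔ Q) (M ⊔ N) h
        hMN = m⊔n≤o⇒n≤o (P ⊔ Q) (M ⊔ N) h
    in subst (λ d → 0ℚ ℚ.≤ seq x n ⊛ seq y n ⊕ d) Aη+Bη≡δ
      (*-almost-nonNeg {seq x n} {seq y n} (ℚ.<⇒≤ η>0) (x≤A n (m⊔n≤o⇒m≤o P Q hPQ)) (y≤B n (m⊔n≤o⇒n≤o P Q hPQ))
        (p n (m⊔n≤o⇒m≤o M N hMN)) (q n (m⊔n≤o⇒n≤o M N hMN)))

*-monoˡ-≤ᴿ : ∀ {x y z} → 0ℝ R.≤ z → x R.≤ y → z R.* x R.≤ z R.* y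
*-monoˡ-≤ᴿ {x} {y} {z} 0≤z x≤y δ δ>0 =
  let N , p = *-nonNeg {z} {y R.- x} 0≤z (x≤y⇒0≤y-x {x} {y} x≤y) δ δ>0
  in N , λ n h → 0≤q-p⇒p≤q (subst (0ℚ ℚ.≤_) (identity (seq x n) (seq y n) (seq z n) δ) (p n h))
  where
  open +-*-Solver
  identity : ∀ x y z d → z ⊛ (y ⊖ x) ⊕ d ≡ z ⊛ y ⊕ d ⊖ z ⊛ x
  identity = solve 4 (λ x y z d → z :* (y :- x) :+ d := z :* y :+ d :- z :* x) refl

*-comm-≤ᴿ : ∀ x y → x R.* y R.≤ y R.* x
*-comm-≤ᴿ x y = pointwise⇒≤ {x R.* y} {y R.* x} λ n → ℚ.≤-reflexive (ℚ.*-comm (seq x n) (seq y n))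

*-mono-≤ᴿ : ∀ {x y z w} → 0ℝ R.≤ x → 0ℝ R.≤ w → x R.≤ y → z R.≤ w → x R.* z R.≤ y R.* w
*-mono-≤ᴿ {x} {y} {z} {w} 0≤x 0≤w x≤y z≤w =
  _⟨≤⟩_ {x R.* z} {x R.* w} {y R.* w} (*-monoˡ-≤ᴿ {z} {w} {x} 0≤x z≤w)
    (_⟨≤⟩_ {x R.* w} {w R.* x} {y R.* w} (*-comm-≤ᴿ x w)
      (_⟨≤⟩_ {w R.* x} {w R.* y} {y R.* w} (*-monoˡ-≤ᴿ {x} {y} {w} 0≤w x≤y) (*-comm-≤ᴿ w y)))

*-pos : ∀ {x y} → 0ℝ R.< x → 0ℝ R.< y → 0ℝ R.< x R.* y
*-pos {x} {y} (δ , δ>0 , M , p) (η , η>0 , N , q) =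
  δ ⊛ η , ℚ.positive⁻¹ _ {{ℚ.pos*pos⇒pos δ {{ℚ.positive δ>0}} η {{ℚ.positive η>0}}}} , M ⊔ N , λ n h →
    subst (ℚ._≤ seq x n ⊛ seq y n) (sym (ℚ.+-identityˡ (δ ⊛ η)))
      (0≤q-p⇒p≤q (subst (0ℚ ℚ.≤_) (identity (seq x n) (seq y n) δ η)
        (0≤p+q (0≤p*q (p≤q⇒0≤q-p (bare (p n (m⊔n≤o⇒m≤o M N h))))
                      (ℚ.≤-trans (ℚ.<⇒≤ η>0) (bare (q n (m⊔n≤o⇒n≤o M N h)))))
               (0≤p*q (ℚ.<⇒≤ δ>0) (p≤q⇒0≤q-p (bare (q n (m⊔n≤o⇒n≤o M N h))))))))
  where
  open +-*-Solver
  bare : ∀ {p q} → 0ℚ ⊕ p ℚ.≤ q → p ℚ.≤ q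
  bare {p} {q} = subst (ℚ._≤ q) (ℚ.+-identityˡ p)
  identity : ∀ x y d e → (x ⊖ d) ⊛ y ⊕ d ⊛ (y ⊖ e) ≡ x ⊛ y ⊖ d ⊛ e
  identity = solve 4 (λ x y d e → (x :- d) :* y :+ d :* (y :- e) := x :* y :- d :* e) refl

-- Natural numbers and finite sums among the reals

natℚ : ℕ → ℚ
natℚ n = ℤ.+ n ℚ./ 1

natℚ≡ : ∀ n → natℚ n ≡ mkℚ (ℤ.+ n) 0 (Coprimality.sym (Coprimality.1-coprimeTo n))
natℚ≡ n = ℚ.normalize-coprime (Coprimality.sym (Coprimality.1-coprimeTo n))

natℚ-+ : ∀ m n → natℚ (m + n) ≡ natℚ m ⊕ natℚ n
natℚ-+ m n = sym (trans (cong₂ _⊕_ (natℚ≡ m) (natℚ≡ n))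
  (cong (ℚ._/ 1) (cong₂ ℤ._+_ (ℤ.*-identityʳ (ℤ.+ m)) (ℤ.*-identityʳ (ℤ.+ n)))))

0≤natℚ : ∀ n → 0ℚ ℚ.≤ natℚ n
0≤natℚ n = ℚ.nonNegative⁻¹ (natℚ n) {{ℚ.normalize-nonNeg n 1}}

natℚ-mono : ∀ {m n} → m ≤ n → natℚ m ℚ.≤ natℚ n
natℚ-mono {m} {n} m≤n = subst (natℚ m ℚ.≤_) (trans (sym (natℚ-+ m (n ∸ m))) (cong natℚ (m+[n∸m]≡n m≤n)))
  (p≤p+q (0≤natℚ (n ∸ m)))

0≤fromℕ : ∀ n → 0ℝ R.≤ fromℕ n
0≤fromℕ n = pointwise⇒≤ {0ℝ} {fromℕ n} λ _ → 0≤natℚ n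

-- At a fixed approximation `n` the laws of sums are equalities of rationals, and no error has to be
-- carried along.
seq-Sum-++ : ∀ n (f : A → ℝ) as bs → seq (Sum (as ++ bs) f) n ≡ seq (Sum as f) n ⊕ seq (Sum bs f) n
seq-Sum-++ n f []       bs = sym (ℚ.+-identityˡ (seq (Sum bs f) n))
seq-Sum-++ n f (a ∷ as) bs = trans (cong (seq (f a) n ⊕_) (seq-Sum-++ n f as bs))
  (sym (ℚ.+-assoc (seq (f a) n) (seq (Sum as f) n) (seq (Sum bs f) n)))

seq-Sum-scale : ∀ {B : Set} n c (f : A → ℝ) (g : B → ℝ) (h : B → A) bs →
  (∀ b → seq (f (h b)) n ≡ c ⊛ seq (g b) n) → seq (Sum (map h bs) f) n ≡ c ⊛ seq (Sum bs g) n
seq-Sum-scale n c f g h []       eq = sym (ℚ.*-zeroʳ c)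
seq-Sum-scale n c f g h (b ∷ bs) eq = trans (cong₂ _⊕_ (eq b) (seq-Sum-scale n c f g h bs eq))
  (sym (ℚ.*-distribˡ-+ c (seq (g b) n) (seq (Sum bs g) n)))

Sum-mono : ∀ {f g : A → ℝ} as → (∀ a → f a R.≤ g a) → Sum as f R.≤ Sum as g
Sum-mono []                 f≤g = pointwise⇒≤ {0ℝ} {0ℝ} λ _ → ℚ.≤-refl
Sum-mono {f = f} {g} (a ∷ as) f≤g = +-mono-≤ᴿ {f a} {g a} {Sum as f} {Sum as g} (f≤g a) (Sum-mono as f≤g)

seq-Sum-fromℕ : ∀ n x (t : A → ℕ) as → seq (Sum as (λ a → x R.* fromℕ (t a))) n ≡ seq x n ⊛ natℚ (∑ as t)
seq-Sum-fromℕ n x t []       = sym (ℚ.*-zeroʳ (seq x n))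
seq-Sum-fromℕ n x t (a ∷ as) = trans (cong (seq x n ⊛ natℚ (t a) ⊕_) (seq-Sum-fromℕ n x t as))
  (trans (sym (ℚ.*-distribˡ-+ (seq x n) (natℚ (t a)) (natℚ (∑ as t)))) (cong (seq x n ⊛_) (sym (natℚ-+ (t a) (∑ as t)))))

seq-½^ : ∀ m n → natℚ (2 ^ m) ⊛ seq (½ℝ R.^ m) n ≡ 1ℚ
seq-½^ zero    n = refl
seq-½^ (suc m) n = begin
  natℚ (2 ^ suc m) ⊛ (½ ⊛ h)      ≡⟨ cong (_⊛ (½ ⊛ h))
                                       (trans (natℚ-+ (2 ^ m) _) (cong (λ k → a ⊕ natℚ k) (+-identityʳ (2 ^ m)))) ⟩
  (a ⊕ a) ⊛ (½ ⊛ h)               ≡⟨ identity a h ½ ⟩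
  ½ ⊛ (a ⊛ h) ⊕ ½ ⊛ (a ⊛ h)       ≡⟨ ½-split (a ⊛ h) ⟩
  a ⊛ h                           ≡⟨ seq-½^ m n ⟩
  1ℚ                              ∎
  where
  open ≡-Reasoning
  open +-*-Solver
  a = natℚ (2 ^ m)
  h = seq (½ℝ R.^ m) n
  identity : ∀ a h c → (a ⊕ a) ⊛ (c ⊛ h) ≡ c ⊛ (a ⊛ h) ⊕ c ⊛ (a ⊛ h)
  identity = solve 3 (λ a h c → (a :+ a) :* (c :* h) := c :* (a :* h) :+ c :* (a :* h)) refl

0≤½ : 0ℝ R.≤ ½ℝ
0≤½ = pointwise⇒≤ {0ℝ} {½ℝ} λ _ → ℚ.<⇒≤ (ℚ.positive⁻¹ ½)

½^-nonNeg : ∀ m → 0ℝ R.≤ ½ℝ R.^ m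
½^-nonNeg zero    = pointwise⇒≤ {0ℝ} {1ℝ} λ _ → ℚ.<⇒≤ 0<1
½^-nonNeg (suc m) = *-nonNeg {½ℝ} {½ℝ R.^ m} 0≤½ (½^-nonNeg m)

-- Flip probabilities

module _ {ε : ℝ} (0≤ε : 0ℝ R.≤ ε) (ε≤½ : ε R.≤ ½ℝ) where

  ½≤1-ε : ½ℝ R.≤ 1ℝ R.- ε
  ½≤1-ε δ δ>0 with ε≤½ δ δ>0
  ... | N , p = N , λ n h → 0≤q-p⇒p≤q (subst (0ℚ ℚ.≤_) (identity (seq ε n) δ) (p≤q⇒0≤q-p (p n h)))
    where
    open +-*-Solver
    identity : ∀ e d → ½ ⊕ d ⊖ e ≡ 1ℚ ⊖ e ⊕ d ⊖ ½
    identity = solve 2 (λ e d → con ½ :+ d :- e := con 1ℚ :- e :+ d :- con ½) refl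

  0≤1-ε : 0ℝ R.≤ 1ℝ R.- ε
  0≤1-ε = _⟨≤⟩_ {0ℝ} {½ℝ} {1ℝ R.- ε} 0≤½ ½≤1-ε

  ε≤1-ε : ε R.≤ 1ℝ R.- ε
  ε≤1-ε = _⟨≤⟩_ {ε} {½ℝ} {1ℝ R.- ε} ε≤½ ½≤1-ε

  pow-nonNeg : ∀ m → 0ℝ R.≤ (1ℝ R.- ε) R.^ m
  pow-nonNeg zero    = pointwise⇒≤ {0ℝ} {1ℝ} λ _ → ℚ.<⇒≤ 0<1
  pow-nonNeg (suc m) = *-nonNeg {1ℝ R.- ε} {(1ℝ R.- ε) R.^ m} 0≤1-ε (pow-nonNeg m)

  flipProb-nonNeg : ∀ x y → 0ℝ R.≤ flipProb ε x y
  flipProb-nonNeg []      []      = pointwise⇒≤ {0ℝ} {1ℝ} λ _ → ℚ.<⇒≤ 0<1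
  flipProb-nonNeg []      (_ ∷ _) = pointwise⇒≤ {0ℝ} {0ℝ} λ _ → ℚ.≤-refl
  flipProb-nonNeg (_ ∷ _) []      = pointwise⇒≤ {0ℝ} {0ℝ} λ _ → ℚ.≤-refl
  flipProb-nonNeg (a ∷ x) (b ∷ y) with a Bool.≟ b
  ... | yes _ = *-nonNeg {1ℝ R.- ε} {flipProb ε x y} 0≤1-ε (flipProb-nonNeg x y)
  ... | no  _ = *-nonNeg {ε} {flipProb ε x y} 0≤ε (flipProb-nonNeg x y)

  -- Each factor is `ε` or `1 - ε`, and `ε ≤ ½ ≤ 1 - ε`: leaving every bit unflipped is the
  -- likeliest outcome.
  flipProb-≤ : ∀ x y → flipProb ε x y R.≤ (1ℝ R.- ε) R.^ length x
  flipProb-≤ []      []      = pointwise⇒≤ {1ℝ} {1ℝ} λ _ → ℚ.≤-refl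
  flipProb-≤ []      (_ ∷ _) = pow-nonNeg 0
  flipProb-≤ (a ∷ x) []      = pow-nonNeg (suc (length x))
  flipProb-≤ (a ∷ x) (b ∷ y) with a Bool.≟ b
  ... | yes _ = *-monoˡ-≤ᴿ {flipProb ε x y} {(1ℝ R.- ε) R.^ length x} {1ℝ R.- ε} 0≤1-ε (flipProb-≤ x y)
  ... | no  _ = *-mono-≤ᴿ {ε} {1ℝ R.- ε} {flipProb ε x y} {(1ℝ R.- ε) R.^ length x}
                  0≤ε (pow-nonNeg (length x)) ε≤1-ε (flipProb-≤ x y)

  flipProb-pos : 0ℝ R.< ε → ∀ x y → length x ≡ length y → 0ℝ R.< flipProb ε x y
  flipProb-pos ε>0 []      []      _  = 1ℚ , 0<1 , 0 , λ _ _ → ℚ.≤-reflexive (ℚ.+-identityˡ 1ℚ)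
  flipProb-pos ε>0 (a ∷ x) (b ∷ y) eq with a Bool.≟ b
  ... | yes _ = *-pos {1ℝ R.- ε} {flipProb ε x y} 1-ε>0 (flipProb-pos ε>0 x y (suc-injective eq))
    where
    1-ε>0 : 0ℝ R.< 1ℝ R.- ε
    1-ε>0 =
      -- `½ ≤ 1 - ε` holds for the approximations only up to an error; allowing the error `¼` leaves
      -- the strict margin `¼`.
      let N , p = ½≤1-ε (½ ⊛ ½) (½-pos (ℚ.positive⁻¹ ½))
      in ½ ⊛ ½ , ½-pos (ℚ.positive⁻¹ ½) , N , λ n h → 0≤q-p⇒p≤q
        (subst (0ℚ ℚ.≤_) (identity (1ℚ ⊖ seq ε n)) (p≤q⇒0≤q-p (p n h)))
      where
      open +-*-Solver
      identity : ∀ u → u ⊕ ½ ⊛ ½ ⊖ ½ ≡ u ⊖ (0ℚ ⊕ ½ ⊛ ½)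
      identity = solve 1 (λ u → u :+ con (½ ⊛ ½) :- con ½ := u :- (con 0ℚ :+ con (½ ⊛ ½))) refl
  ... | no  _ = *-pos {ε} {flipProb ε x y} ε>0 (flipProb-pos ε>0 x y (suc-injective eq))

seq-flipProb-≢ : ∀ ε n x y → length x ≢ length y → seq (flipProb ε x y) n ≡ 0ℚ
seq-flipProb-≢ ε n []      []      ≢ = ⊥-elim (≢ refl)
seq-flipProb-≢ ε n []      (_ ∷ _) ≢ = refl
seq-flipProb-≢ ε n (_ ∷ _) []      ≢ = refl
seq-flipProb-≢ ε n (a ∷ x) (b ∷ y) ≢ with a Bool.≟ b
... | yes _ = trans (cong ((1ℚ ⊖ seq ε n) ⊛_) (seq-flipProb-≢ ε n x y (≢ ∘ cong suc))) (ℚ.*-zeroʳ (1ℚ ⊖ seq ε n))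
... | no  _ = trans (cong (seq ε n ⊛_) (seq-flipProb-≢ ε n x y (≢ ∘ cong suc))) (ℚ.*-zeroʳ (seq ε n))

flipProb-pos⇒length : ∀ ε x y → 0ℝ R.< flipProb ε x y → length x ≡ length y
flipProb-pos⇒length ε x y (δ , δ>0 , N , p) with length x ≟ℕ length y
... | yes eq = eq
... | no  ≢  = ⊥-elim (ℚ.<-irrefl refl (ℚ.<-≤-trans δ>0
  (subst₂ ℚ._≤_ (ℚ.+-identityˡ δ) (seq-flipProb-≢ ε N x y ≢) (p N ≤-refl))))

-- The weights `1 - e` and `e` add up to 1 for every rational `e`, so each approximation has total
-- exactly 1, even where `e` lies outside the unit interval.
seq-total : ∀ ε n x → seq (Sum (strings (length x)) (flipProb ε x)) n ≡ 1ℚ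
seq-total ε n []      = ℚ.+-identityʳ 1ℚ
seq-total ε n (a ∷ x) = begin
  seq (Sum (strings (suc m)) (flipProb ε (a ∷ x))) n
    ≡⟨ seq-Sum-++ n (flipProb ε (a ∷ x)) (map (false ∷_) (strings m)) (map (true ∷_) (strings m)) ⟩
  seq (Sum (map (false ∷_) (strings m)) (flipProb ε (a ∷ x))) n ⊕
  seq (Sum (map (true ∷_) (strings m)) (flipProb ε (a ∷ x))) n
    ≡⟨ cong₂ _⊕_ (half false) (half true) ⟩
  weight a false ⊛ s ⊕ weight a true ⊛ s
    ≡⟨ cong (λ t → weight a false ⊛ t ⊕ weight a true ⊛ t) (seq-total ε n x) ⟩
  weight a false ⊛ 1ℚ ⊕ weight a true ⊛ 1ℚ
    ≡⟨ one a ⟩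
  1ℚ ∎
  where
  open ≡-Reasoning
  open +-*-Solver
  m = length x
  e = seq ε n
  s = seq (Sum (strings m) (flipProb ε x)) n
  weight : Bool → Bool → ℚ
  weight a b = if does (a Bool.≟ b) then 1ℚ ⊖ e else e
  weigh : ∀ b y → seq (flipProb ε (a ∷ x) (b ∷ y)) n ≡ weight a b ⊛ seq (flipProb ε x y) n
  weigh b y with a Bool.≟ b
  ... | yes _ = refl
  ... | no  _ = refl
  half : ∀ b → seq (Sum (map (b ∷_) (strings m)) (flipProb ε (a ∷ x))) n ≡ weight a b ⊛ s
  half b = seq-Sum-scale n (weight a b) (flipProb ε (a ∷ x)) (flipProb ε x) (b ∷_) (strings m) (weigh b)
  one : ∀ a → weight a false ⊛ 1ℚ ⊕ weight a true ⊛ 1ℚ ≡ 1ℚ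
  one false = solve 1 (λ e → (con 1ℚ :- e) :* con 1ℚ :+ e :* con 1ℚ := con 1ℚ) refl e
  one true  = solve 1 (λ e → e :* con 1ℚ :+ (con 1ℚ :- e) :* con 1ℚ := con 1ℚ) refl e

strings-unique : ∀ m → Unique (strings m)
strings-unique zero    = All.[] ∷ []
strings-unique (suc m) = Unique.++⁺
  (Unique.map⁺ ∷-injectiveʳ (strings-unique m)) (Unique.map⁺ ∷-injectiveʳ (strings-unique m))
  λ { (f , t) → clashing (∈-map⁻ (false ∷_) f) (∈-map⁻ (true ∷_) t) }
  where
  clashing : ∀ {v} → (∃ λ u → u ∈ strings m × v ≡ false ∷ u) → (∃ λ u → u ∈ strings m × v ≡ true ∷ u) → ⊥
  clashing (_ , _ , refl) (_ , _ , ())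

∈-strings⁺ : ∀ u → u ∈ strings (length u)
∈-strings⁺ []          = here refl
∈-strings⁺ (false ∷ u) = ∈-++⁺ˡ (∈-map⁺ (false ∷_) (∈-strings⁺ u))
∈-strings⁺ (true ∷ u)  = ∈-++⁺ʳ (map (false ∷_) (strings (length u))) (∈-map⁺ (true ∷_) (∈-strings⁺ u))

-- The algorithm on the smoothed G(n,p)

module _ (disc : Discretization) where
  open Discretization disc

  length-instance : ∀ {n x} → GraphCode n x → length x ≡ n C 2
  length-instance (_ , G , refl) = length-encode G

  0≤φ : ∀ {n} (p : Param n) → 0ℝ R.≤ φ p
  0≤φ {n} p = _⟨≤⟩_ {0ℝ} {½ℝ R.^ (n C 2)} {φ p} (½^-nonNeg (n C 2)) (φ-lower p)

  flipProb-≤φ : ∀ {n x} → GraphCode n x → ∀ p y → flipProb (ε p) x y R.≤ φ {n} p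
  flipProb-≤φ {n} {x} i p y = _⟨≤⟩_ {flipProb (ε p) x y} {(1ℝ R.- ε p) R.^ (n C 2)} {φ p}
    (subst (λ m → flipProb (ε p) x y R.≤ (1ℝ R.- ε p) R.^ m) (length-instance i)
      (flipProb-≤ (ε-lower p) (ε-upper p) x y))
    (proj₁ (ε-spec p))

  smoothedGnp-family : IsParameterizedFamily (smoothedGnp disc)
  smoothedGnp-family = record
    { S              = λ n x i → strings (n C 2)
    ; S-unique       = λ {n} i → strings-unique (n C 2)
    ; S-spec         = λ {n} {x} i y → mk⇔
        (λ y∈ → let p , ε>0 = nondegenerate n in
          p , flipProb-pos (ε-lower p) (ε-upper p) ε>0 x y (trans (length-instance i) (sym (∈-strings⁻ (n C 2) y∈))))
        (λ { (p , pos) → subst (λ m → y ∈ strings m)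
          (trans (sym (flipProb-pos⇒length (ε p) x y pos)) (length-instance i)) (∈-strings⁺ y) })
    ; nonNegative    = λ {n} {x} i p y → flipProb-nonNeg (ε-lower p) (ε-upper p) x y
    ; total          = λ {n} {x} i p → subst (λ m → Sum (strings m) (flipProb (ε p) x) R.≈ 1ℝ) (length-instance i)
        (pointwise⇒≈ {Sum (strings (length x)) (flipProb (ε p) x)} {1ℝ} λ m → seq-total (ε p) m x)
    ; S-length       = 2 , λ {n} i y∈ → subst (_≤ poly 2 n) (sym (∈-strings⁻ (n C 2) y∈)) (C2≤ n)
    ; code-length    = proj₁ code-length , λ _ → proj₂ code-length
    ; code-injective = λ _ → code-injective
    ; value-lower    = λ {n} i p → subst (λ N → 1ℝ R.≤ fromℕ N R.* φ p) (sym (length-strings (n C 2)))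
        (_⟨≤⟩_ {1ℝ} {fromℕ (2 ^ (n C 2)) R.* ½ℝ R.^ (n C 2)} {fromℕ (2 ^ (n C 2)) R.* φ p}
          (pointwise⇒≤ {1ℝ} {fromℕ (2 ^ (n C 2)) R.* ½ℝ R.^ (n C 2)} λ m → ℚ.≤-reflexive (sym (seq-½^ (n C 2) m)))
          (*-monoˡ-≤ᴿ {½ℝ R.^ (n C 2)} {φ p} {fromℕ (2 ^ (n C 2))} (0≤fromℕ (2 ^ (n C 2))) (φ-lower p)))
    ; value-upper    = λ _ → φ-upper
    ; D-upper        = flipProb-≤φ
    }
    where
    width≤ : ∀ n → width 0 n ≤ n * n
    width≤ zero    = z≤n
    width≤ (suc n) = begin
      width 0 (suc n)    ≡⟨ width-∷ʳ 0 n ⟩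
      width 0 n + n      ≤⟨ +-monoˡ-≤ n (width≤ n) ⟩
      n * n + n          ≡⟨ +-comm (n * n) n ⟩
      suc n * n          ≤⟨ *-monoʳ-≤ (suc n) (n≤1+n n) ⟩
      suc n * suc n      ∎
      where open ≤-Reasoning
    C2≤ : ∀ n → n C 2 ≤ poly 2 n
    C2≤ n = subst₂ _≤_ (width-C2 n) (cong (_+ 2) (cong (n *_) (sym (*-identityʳ n)))) (≤-trans (width≤ n) (m≤m+n _ 2))

  module _ (k : ℕ) where
    open Machine k

    -- The depth `suc (length y)` suffices for every string, so the time is defined whether or not
    -- the length of `y` fits `n`.
    time : Str → ℕ → Str → ℕ
    time y n w = proj₁ (proj₂ (decides (suc (length y)) y n w (≤-width 0 (length y)) (s≤s z≤n)))

    searcher-decides : Decides searcher (kColoring k) (smoothedGnp disc)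
    searcher-decides = record
      { time    = time
      ; correct = λ {n} i p y →
          let b , t , run , ok , _ = decides (suc (length y)) y n (code p) (≤-width 0 (length y)) (s≤s z≤n)
          in b , run , ⇔.trans ok (⇔.sym (kColoring⇔ext k y))
      }

    -- At the root all classes are empty, so `searchBound` is `2 * (7 * k + 1) * 2 ^ (k * (k + 2) *
    -- (k + 3) / 2)`, free of `n`. The 3 is for the final rejection.
    searchBound average : ℕ
    searchBound = bound k 0 (2 ^ energy (2 + k) ([] {A = Fin k}))
    average     = searchBound + 3

    ∑-time : ∀ n w → 0 < n → ∑ (strings (n C 2)) (λ y → time y n w) ≤ average * 2 ^ (n C 2)
    ∑-time n w 0<n = begin
      ∑ (strings m) (λ y → time y n w)
        ≤⟨ ∑-mono (strings m) (λ {y} y∈ → time≤ y (∈-strings⁻ m y∈)) ⟩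
      ∑ (strings m) (λ y → cost n [] y + 3)
        ≡⟨ ∑-+ (cost n []) (λ _ → 3) (strings m) ⟩
      ∑ (strings m) (cost n []) + ∑ (strings m) (λ _ → 3)
        ≡⟨ cong (∑ (strings m) (cost n []) +_) (trans (∑-const 3 (strings m)) (cong (_* 3) (length-strings m))) ⟩
      ∑ (strings m) (cost n []) + 2 ^ m * 3
        ≤⟨ +-monoˡ-≤ (2 ^ m * 3)
             (subst (λ l → ∑ (strings l) (cost n []) ≤ 2 ^ l * searchBound) (width-C2 n) (∑-cost k n [])) ⟩
      2 ^ m * searchBound + 2 ^ m * 3
        ≡⟨ *-distribˡ-+ (2 ^ m) searchBound 3 ⟨
      2 ^ m * average
        ≡⟨ *-comm (2 ^ m) average ⟩
      average * 2 ^ m ∎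
      where
      open ≤-Reasoning
      m = n C 2
      time≤ : ∀ y → length y ≡ m → time y n w ≤ cost n [] y + 3
      time≤ y len =
        let _ , _ , run  , _     = decides (suc (length y)) y n w (≤-width 0 (length y)) (s≤s z≤n)
            _ , _ , run′ , _ , s≤ = decides n y n w (≤-reflexive (trans len (sym (width-C2 n)))) 0<n
        in subst (_≤ cost n [] y + 3) (⇓-functional run′ run) s≤

    searcher-smoothed : SmoothedPolynomial smoothedGnp-family time
    searcher-smoothed = 1ℚ , 0<1 , average , λ {n} {x} i p → fromℕ ∘ runtime i p ,
      (λ y → 0≤fromℕ (runtime i p y) ,
        pointwise⇒≈ {fromℕ (runtime i p y) R.^ 1} {fromℕ (runtime i p y ^ 1)} λ _ →
          trans (ℚ.*-identityʳ (natℚ (runtime i p y))) (cong natℚ (sym (*-identityʳ (runtime i p y))))) ,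
      expectation i p
      where
      runtime : ∀ {n x} → GraphCode n x → Param n → Str → ℕ
      runtime {n} _ p y = time y n (code p)
      expectation : ∀ {n x} (i : GraphCode n x) p →
        Sum (strings (n C 2)) (λ y → flipProb (ε p) x y R.* fromℕ (runtime i p y)) R.≤
        fromℕ (average * (n * length (strings (n C 2)))) R.* φ p
      expectation {n} {x} i p =
        _⟨≤⟩_ {Sum ys (λ y → flipProb (ε p) x y R.* fromℕ (t y))} {Sum ys (λ y → φ p R.* fromℕ (t y))} {fromℕ M R.* φ p}
          (Sum-mono {f = λ y → flipProb (ε p) x y R.* fromℕ (t y)} {λ y → φ p R.* fromℕ (t y)} ys λ y →
            *-mono-≤ᴿ {flipProb (ε p) x y} {φ p} {fromℕ (t y)} {fromℕ (t y)}
              (flipProb-nonNeg (ε-lower p) (ε-upper p) x y) (0≤fromℕ (t y)) (flipProb-≤φ i p y)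
              (pointwise⇒≤ {fromℕ (t y)} {fromℕ (t y)} λ _ → ℚ.≤-refl))
          (_⟨≤⟩_ {Sum ys (λ y → φ p R.* fromℕ (t y))} {φ p R.* fromℕ M} {fromℕ M R.* φ p}
            (_⟨≤⟩_ {Sum ys (λ y → φ p R.* fromℕ (t y))} {φ p R.* fromℕ (∑ ys t)} {φ p R.* fromℕ M}
              (pointwise⇒≤ {Sum ys (λ y → φ p R.* fromℕ (t y))} {φ p R.* fromℕ (∑ ys t)} λ m →
                ℚ.≤-reflexive (seq-Sum-fromℕ m (φ p) t ys))
              (*-monoˡ-≤ᴿ {fromℕ (∑ ys t)} {fromℕ M} {φ p} (0≤φ p)
                (pointwise⇒≤ {fromℕ (∑ ys t)} {fromℕ M} λ _ → natℚ-mono mean)))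
            (*-comm-≤ᴿ (φ p) (fromℕ M)))
        where
        ys = strings (n C 2)
        M = average * (n * length ys)
        t = runtime i p
        mean : ∑ ys t ≤ M
        -- A graph has `n ≥ 1` vertices, so the factor `n` can be inserted.
        mean = ≤-trans (∑-time n (code p) (>-nonZero⁻¹ n {{proj₁ i}}))
          (*-monoʳ-≤ average (subst (2 ^ (n C 2) ≤_) (cong (n *_) (sym (length-strings (n C 2))))
            (m≤n*m (2 ^ (n C 2)) n {{proj₁ i}})))

theorem7p1 : (k : ℕ) (disc : Discretization) → SmoothedP (kColoring k) (smoothedGnp disc)
theorem7p1 k disc = smoothedGnp-family disc , Machine.searcher k , searcher-decides disc k , searcher-smoothed disc k
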